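{- Every 3-tree is odd $5$-colorable.
   Context: All graphs are simple, finite and undirected. A $5$-coloring of a graph $G$ is a map $\varphi:V(G)\to\{1,\dots,5\}$ with $\varphi(u)\neq\varphi(v)$ for every edge $uv$. A vertex $v$ satisfies the odd condition with respect to $\varphi$ if $|\varphi^{ -1}(i)\cap N_G(v)|$ is odd for some color $i$. An odd $5$-coloring is a $5$-coloring in which every non-isolated vertex satisfies the odd condition. A graph $G$ is a 3-tree if there is a sequence $G_0,\dots,G_s$ of induced subgraphs of $G$ with $G_0\cong K_4$, $G_s=G$, and for each $i\in\{1,\dots,s\}$, $V(G_i)=V(G_{i-1})\cup\{x_i\}$ for a new vertex $x_i$ whose neighbors in $V(G_{i-1})$ form a clique of order $3$ of $G$. -}

module Defs where

open import Data.Nat using (ℕ; zero; suc; _+_; _≤_; _<_; _%_)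
open import Data.Fin using (Fin; toℕ)
open import Data.Fin.Properties using (_≟_)
open import Data.Bool using (Bool; true; false; _∧_; if_then_else_)
open import Data.List using (List; map; allFin)
open import Data.Nat.ListAction using (sum)
open import Data.Product using (Σ; ∃; ∃-syntax; _×_; _,_)
open import Data.Sum using (_⊎_)
open import Relation.Nullary using (¬_)
open import Relation.Nullary.Decidable using (⌊_⌋)
open import Relation.Binary.PropositionalEquality using (_≡_; _≢_)
open import Function.Definitions using (Injective)

record Graph (n : ℕ) : Set where
  field
    adj   : Fin n → Fin n → Bool
    sym   : ∀ u v → adj u v ≡ adj v u
    irrefl : ∀ v → adj v v ≡ false

open Graph public

Adj : {n : ℕ} → Graph n → Fin n → Fin n → Set
Adj G u v = adj G u v ≡ true

-- A 3-tree: there is an ordering σ of the vertices (σ injective, hence a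
-- bijection of Fin n) such that the first four vertices σ 0..σ 3 span a K4
-- (G_0 ≅ K4) and every later vertex σ i (i ≥ 4) has, among the earlier
-- vertices σ j (j < i), exactly the neighbours σ a, σ b, σ c, where
-- a, b, c < i are distinct and σ a, σ b, σ c form a clique (triangle) of G.
-- G_k is the subgraph induced by σ 0, …, σ (k+3).
IsThreeTree : {n : ℕ} → Graph n → Set
IsThreeTree {n} G =
  4 ≤ n ×
  Σ (Fin n → Fin n) λ σ →
    Injective _≡_ _≡_ σ ×
    (∀ (i j : Fin n) → toℕ i < 4 → toℕ j < 4 → i ≢ j → Adj G (σ i) (σ j)) ×
    (∀ (i : Fin n) → 4 ≤ toℕ i →
      ∃[ a ] ∃[ b ] ∃[ c ]
        (toℕ a < toℕ i × toℕ b < toℕ i × toℕ c < toℕ i) ×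
        (a ≢ b × b ≢ c × a ≢ c) ×
        (Adj G (σ a) (σ b) × Adj G (σ b) (σ c) × Adj G (σ a) (σ c)) ×
        (∀ (j : Fin n) → toℕ j < toℕ i →
          (Adj G (σ i) (σ j) → (j ≡ a ⊎ j ≡ b ⊎ j ≡ c)) ×
          ((j ≡ a ⊎ j ≡ b ⊎ j ≡ c) → Adj G (σ i) (σ j))))

IsProperColoring : {n k : ℕ} → Graph n → (Fin n → Fin k) → Set
IsProperColoring G φ = ∀ u v → Adj G u v → φ u ≢ φ v

nbrColorCount : {n k : ℕ} → Graph n → (Fin n → Fin k) → Fin n → Fin k → ℕ
nbrColorCount {n} G φ v i =
  sum (map (λ u → if adj G v u ∧ ⌊ φ u ≟ i ⌋ then 1 else 0) (allFin n))

Odd : ℕ → Set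
Odd m = m % 2 ≡ 1

IsIsolated : {n : ℕ} → Graph n → Fin n → Set
IsIsolated G v = ∀ u → ¬ Adj G v u

IsOddColoring : {n k : ℕ} → Graph n → (Fin n → Fin k) → Set
IsOddColoring {k = k} G φ =
  IsProperColoring G φ ×
  (∀ v → ¬ IsIsolated G v → ∃[ i ] Odd (nbrColorCount G φ v i))

OddColorable : {n : ℕ} → ℕ → Graph n → Set
OddColorable {n} k G = Σ (Fin n → Fin k) λ φ → IsOddColoring G φ

{-# OPTIONS --safe #-}

-- Process the construction of the 3-tree backwards. What hangs on a triangle is summarised by the set of
-- contributions that its colourings, with every hanging vertex satisfied, can make to the parity vectors
-- (in F₂⁵, one coordinate per colour) of the three corners. Hanging parts on the same triangle are summed, and a last
-- vertex together with the parts on its three triangles becomes one part on the triangle of its neighbours.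
-- Up to taking supersets only a few sets occur: the zero contribution, the two contributions of a single
-- vertex, and sets that avoid every target triple (no corner receives exactly its target) except for
-- a short list of exceptions. Closure of these types under both operations is a finite game, in which the
-- opponent's target is constrained by disjunctions of equations that are solved by exhaustive substitution.
-- A vertex is satisfied iff its parity vector is nonzero, that is, if the contribution misses the target
-- given by the rest of the graph. Once the tree is reduced to one triangle, all types avoid the last target.

module Submission where

open import Defs hiding (sym)
open import Algebra.Bundles using (CommutativeMonoid)
import Algebra.Properties.CommutativeMonoid.Sum as CommutativeMonoidSum
import Algebra.Solver.CommutativeMonoid as CommutativeMonoidSolver
open import Data.Bool using (Bool; true; false; if_then_else_; not; _xor_; _∧_; _∨_)
open import Data.Bool.Properties using (xor-assoc; xor-comm; xor-identityˡ; xor-identityʳ; xor-same; not-distribˡ-xor; not-involutive; ¬-not) renaming (_≟_ to _≟ᵇ_)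
open import Data.Empty using (⊥; ⊥-elim)
open import Data.Fin using (Fin; zero; suc; toℕ; fromℕ<; inject₁; punchIn; punchOut; _↑ˡ_)
open import Data.Fin.Patterns using (0F; 1F; 2F; 3F; 4F)
open import Data.Fin.Permutation using (Permutation′; permutation; _⟨$⟩ʳ_; _⟨$⟩ˡ_; _∘ₚ_; flip; insert; transpose; inverseˡ; inverseʳ) renaming (id to idₚ)
open import Data.Fin.Properties using (_≟_; all?; any?; punchIn-punchOut; punchOut-punchIn; punchOut-injective; punchInᵢ≢i; toℕ-injective; toℕ<n; toℕ-fromℕ<; injective⇒≤)
open import Data.List as List using (List; []; _∷_; _++_; concatMap; cartesianProduct)
import Data.List.Membership.DecPropositional as DecMembership
open import Data.List.Membership.Propositional using (_∈_; find; lose)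
open import Data.List.Membership.Propositional.Properties using (∈-cartesianProduct⁻; ∈-filter⁺; ∈-allFin)
open import Data.List.Properties using (map-tabulate)
open import Data.List.Relation.Unary.All as All using (All; []; _∷_)
open import Data.List.Relation.Unary.All.Properties using (¬All⇒Any¬; ++⁺; map⁺)
open import Data.List.Relation.Unary.Any as Any using (Any; here; there)
import Data.List.Relation.Unary.Any.Properties as Anyₚ
open import Data.Nat using (ℕ; zero; suc; _+_; _≤_; _<_; z≤n; s≤s; s≤s⁻¹)
open import Data.Nat.ListAction using (sum)
open import Data.Nat.Properties using (<-trans; <-irrefl; <-cmp; ≤∧≢⇒<; m≤n⇒m<n∨m≡n; n<1+n; m<n⇒m<1+n; 1+n≰n) renaming (_≟_ to _≟ⁿ_)
open import Data.Product using (∃₂; ∃-syntax; _×_; _,_; proj₁; proj₂)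
open import Data.Product.Properties using () renaming (≡-dec to ×-≡-dec)
open import Data.Sum as Sum using (_⊎_; inj₁; inj₂; [_,_]′)
open import Data.Vec as Vec using (Vec; []; _∷_; lookup; zipWith; replicate; tabulate; insertAt; removeAt)
open import Data.Vec.Properties using (≡-dec; lookup-zipWith; lookup-map; lookup-replicate; lookup∘tabulate; tabulate∘lookup; tabulate-cong; zipWith-assoc; zipWith-comm; zipWith-identityˡ; zipWith-identityʳ; insertAt-lookup; insertAt-punchIn; map-insertAt; map-∘; map-cong; removeAt-punchOut)
open import Function using (_∘_; id)
open import Function.Definitions using (Injective)
open import Level using (0ℓ)
open import Relation.Binary.Definitions using (tri<; tri≈; tri>)
open import Relation.Binary.PropositionalEquality using (_≡_; _≢_; refl; sym; trans; cong; cong₂; subst; subst₂; isEquivalence; module ≡-Reasoning)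
open import Relation.Nullary using (¬_; Dec; yes; no; ¬?; contradiction)
open import Relation.Nullary.Decidable using (⌊_⌋; map′; _×-dec_; _⊎-dec_; _→-dec_; does; from-yes)
open import Relation.Unary using (Pred; Decidable)

-- Parity vectors

-- No vertex is settled when it is coloured, since each later neighbour changes its parity vector;
-- this rules out a greedy colouring in the order of construction. Backwards, the difficulty becomes
-- one of quantifiers: the colours inside a hanging part may be chosen in reply to the rest of the
-- graph, which matters only through one forbidden vector per corner. Hence a type records the
-- targets against which some reply exists. The corners use three of the five colours, so a small
-- part has few colourings and cannot answer every target; this is where the exceptions come from.
-- They stay harmless because one part can be played so that the next one is not handed an
-- exception. Types are stated with the corner colours renamed to 0, 1, 2 and must hold for every
-- renaming, since the triangle of a part may end up coloured in any way.

Parity : Set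
Parity = Vec Bool 5

infixl 6 _⊕_ _⊞_

_⊕_ : Parity → Parity → Parity
_⊕_ = zipWith _xor_

𝟎 : Parity
𝟎 = replicate 5 false

unit : Fin 5 → Parity
unit c = tabulate (λ i → does (c ≟ i))

set : List (Fin 5) → Parity
set = List.foldr (λ c v → unit c ⊕ v) 𝟎

⊕-assoc : ∀ u v w → (u ⊕ v) ⊕ w ≡ u ⊕ (v ⊕ w)
⊕-assoc = zipWith-assoc xor-assoc

⊕-comm : ∀ u v → u ⊕ v ≡ v ⊕ u
⊕-comm = zipWith-comm xor-comm

⊕-identityˡ : ∀ v → 𝟎 ⊕ v ≡ v
⊕-identityˡ = zipWith-identityˡ xor-identityˡ

⊕-identityʳ : ∀ v → v ⊕ 𝟎 ≡ v
⊕-identityʳ = zipWith-identityʳ xor-identityʳ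

zipWith-xor-same : ∀ {n} (v : Vec Bool n) → zipWith _xor_ v v ≡ replicate n false
zipWith-xor-same []      = refl
zipWith-xor-same (b ∷ v) = cong₂ _∷_ (xor-same b) (zipWith-xor-same v)

⊕-same : ∀ v → v ⊕ v ≡ 𝟎
⊕-same = zipWith-xor-same

⊕-cancelʳ : ∀ u v → (u ⊕ v) ⊕ v ≡ u
⊕-cancelʳ u v = trans (⊕-assoc u v v) (trans (cong (u ⊕_) (⊕-same v)) (⊕-identityʳ u))

⊕-moveʳ : ∀ {u w} v → u ⊕ v ≡ w → u ≡ w ⊕ v
⊕-moveʳ v refl = sym (⊕-cancelʳ _ v)

⊕-moveˡ : ∀ {u w} v → v ⊕ u ≡ w → u ≡ w ⊕ v
⊕-moveˡ v eq = ⊕-moveʳ v (trans (⊕-comm _ v) eq)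

⊕-commutativeMonoid : CommutativeMonoid 0ℓ 0ℓ
⊕-commutativeMonoid = record
  { _∙_ = _⊕_
  ; ε   = 𝟎
  ; isCommutativeMonoid = record
    { isMonoid = record
      { isSemigroup = record
        { isMagma = record { isEquivalence = isEquivalence ; ∙-cong = cong₂ _⊕_ }
        ; assoc   = ⊕-assoc
        }
      ; identity = ⊕-identityˡ , ⊕-identityʳ
      }
    ; comm = ⊕-comm
    }
  }

_≟ᵖ_ : (u v : Parity) → Dec (u ≡ v)
_≟ᵖ_ = ≡-dec _≟ᵇ_

_⊞_ : ∀ {n} → Vec Parity n → Vec Parity n → Vec Parity n
_⊞_ = zipWith _⊕_

⊞-assoc : ∀ {n} (u v w : Vec Parity n) → (u ⊞ v) ⊞ w ≡ u ⊞ (v ⊞ w)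
⊞-assoc = zipWith-assoc ⊕-assoc

⊞-comm : ∀ {n} (u v : Vec Parity n) → u ⊞ v ≡ v ⊞ u
⊞-comm = zipWith-comm ⊕-comm

lookup-⊞ : ∀ {n} (i : Fin n) (u v : Vec Parity n) → lookup (u ⊞ v) i ≡ lookup u i ⊕ lookup v i
lookup-⊞ = lookup-zipWith _⊕_

-- Relabelling the colours

push : Permutation′ 5 → Parity → Parity
push π v = tabulate (λ c → lookup v (π ⟨$⟩ˡ c))

lookup-push : ∀ π v c → lookup (push π v) c ≡ lookup v (π ⟨$⟩ˡ c)
lookup-push π v c = lookup∘tabulate (λ c → lookup v (π ⟨$⟩ˡ c)) c

lookup-ext : ∀ {A : Set} {n} (u v : Vec A n) → (∀ i → lookup u i ≡ lookup v i) → u ≡ v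
lookup-ext u v eq = trans (sym (tabulate∘lookup u)) (trans (tabulate-cong eq) (tabulate∘lookup v))

push-⊕ : ∀ π u v → push π (u ⊕ v) ≡ push π u ⊕ push π v
push-⊕ π u v = lookup-ext _ _ λ c → begin
  lookup (push π (u ⊕ v)) c                        ≡⟨ lookup-push π (u ⊕ v) c ⟩
  lookup (u ⊕ v) (π ⟨$⟩ˡ c)                        ≡⟨ lookup-zipWith _xor_ (π ⟨$⟩ˡ c) u v ⟩
  lookup u (π ⟨$⟩ˡ c) xor lookup v (π ⟨$⟩ˡ c)      ≡⟨ cong₂ _xor_ (lookup-push π u c) (lookup-push π v c) ⟨
  lookup (push π u) c xor lookup (push π v) c      ≡⟨ lookup-zipWith _xor_ c (push π u) (push π v) ⟨
  lookup (push π u ⊕ push π v) c                   ∎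
  where open ≡-Reasoning

push-𝟎 : ∀ π → push π 𝟎 ≡ 𝟎
push-𝟎 π = lookup-ext _ _ λ c → trans (lookup-push π 𝟎 c)
  (trans (lookup-replicate (π ⟨$⟩ˡ c) false) (sym (lookup-replicate c false)))

push-∘ : ∀ ρ π v → push (ρ ∘ₚ π) v ≡ push π (push ρ v)
push-∘ ρ π v = lookup-ext _ _ λ c → trans (lookup-push (ρ ∘ₚ π) v c)
  (sym (trans (lookup-push π (push ρ v) c) (lookup-push ρ v (π ⟨$⟩ˡ c))))

push-flip : ∀ π v → push π (push (flip π) v) ≡ v
push-flip π v = lookup-ext _ _ λ c → trans (lookup-push π (push (flip π) v) c)
  (trans (lookup-push (flip π) v (π ⟨$⟩ˡ c)) (cong (lookup v) (inverseʳ π)))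

push-unit : ∀ π c → push π (unit c) ≡ unit (π ⟨$⟩ʳ c)
push-unit π c = lookup-ext _ _ λ i → trans (lookup-push π (unit c) i)
  (trans (lookup-unit c (π ⟨$⟩ˡ i)) (trans (same i) (sym (lookup-unit (π ⟨$⟩ʳ c) i))))
  where
  lookup-unit : ∀ c i → lookup (unit c) i ≡ does (c ≟ i)
  lookup-unit c i = lookup∘tabulate (λ i → does (c ≟ i)) i
  same : ∀ i → does (c ≟ (π ⟨$⟩ˡ i)) ≡ does ((π ⟨$⟩ʳ c) ≟ i)
  same i with c ≟ (π ⟨$⟩ˡ i) | (π ⟨$⟩ʳ c) ≟ i
  ... | yes _  | yes _  = refl
  ... | no _   | no _   = refl
  ... | yes p  | no ¬q  = contradiction (trans (cong (π ⟨$⟩ʳ_) p) (inverseʳ π)) ¬q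
  ... | no ¬p  | yes q  = contradiction (trans (sym (inverseˡ π)) (cong (π ⟨$⟩ˡ_) q)) ¬p

-- Systems of disjunctions of equations

-- (i , v) is the equation "the i-th coordinate is v".
Equation : ℕ → Set
Equation n = Fin n × Parity

Conjunction Clause : ℕ → Set
Conjunction n = List (Equation n)
Clause n      = List (Conjunction n)

Solves : ∀ {n} → Vec Parity n → Conjunction n → Set
Solves t = All (λ (i , v) → lookup t i ≡ v)

solves? : ∀ {n} (t : Vec Parity n) → Decidable (Solves t)
solves? t = All.all? λ (i , v) → lookup t i ≟ᵖ v

Consistent : ∀ {n} → Conjunction n → Conjunction n → Set
Consistent p q = All (λ (i , v) → All (λ (j , w) → i ≡ j → v ≡ w) q) p

consistent? : ∀ {n} (p q : Conjunction n) → Dec (Consistent p q)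
consistent? p q = All.all? (λ (i , v) → All.all? (λ (j , w) → (i ≟ j) →-dec (v ≟ᵖ w)) q) p

solves⇒consistent : ∀ {n} (t : Vec Parity n) {p q} → Solves t p → Solves t q → Consistent p q
solves⇒consistent t tp tq = All.map (λ eq → All.map (λ { eq′ refl → trans (sym eq) eq′ }) tq) tp

-- A disjunctive normal form whose inconsistent branches are cut at once. It stands in for a search
-- through all targets, of which a triangle has 2^15.
solutions : ∀ {n} → Conjunction n → List (Clause n) → List (Conjunction n)
solutions σ []       = σ ∷ []
solutions σ (c ∷ cs) = concatMap extend c
  where
  extend : _ → _
  extend p = if does (consistent? p σ) then solutions (p ++ σ) cs else []

solutions-complete : ∀ {n} (t : Vec Parity n) {σ} cs → Solves t σ →
  All (Any (Solves t)) cs → Any (Solves t) (solutions σ cs)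
solutions-complete t []       tσ []         = here tσ
solutions-complete t {σ} (c ∷ cs) tσ (tc ∷ tcs) = Anyₚ.concatMap⁺ _ (Any.map extend tc)
  where
  extend : ∀ {p} → Solves t p →
    Any (Solves t) (if does (consistent? p σ) then solutions (p ++ σ) cs else [])
  extend {p} tp with consistent? p σ
  ... | yes _ = solutions-complete t cs (++⁺ tp tσ) tcs
  ... | no ¬c = contradiction (solves⇒consistent t tp tσ) ¬c

-- Here `clause x` lists the ways in which the move `x` fails against `t`. If no branch of the
-- system fits `t`, the moves cannot all fail.
violated : ∀ {n} {A : Set} (t : Vec Parity n) {σ} (clause : A → Clause n) (xs : List A) →
  Solves t σ → ¬ Any (Solves t) (solutions σ (List.map clause xs)) →
  ∃[ x ] x ∈ xs × ¬ Any (Solves t) (clause x)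
violated t clause xs tσ none =
  find (Anyₚ.map⁻ (¬All⇒Any¬ (Any.any? (solves? t)) _ (λ all → none (solutions-complete t _ tσ all))))

¬Any[] : ∀ {A : Set} {P : A → Set} {xs} → xs ≡ [] → ¬ Any P xs
¬Any[] refl ()

-- Types of hanging parts

next : Fin 3 → Fin 3
next 0F = 1F
next 1F = 2F
next 2F = 0F

prev : Fin 3 → Fin 3
prev k = next (next k)

place : ∀ {A : Set} → Fin 3 → A → A → A → Vec A 3
place 0F u v w = u ∷ v ∷ w ∷ []
place 1F u v w = w ∷ u ∷ v ∷ []
place 2F u v w = v ∷ w ∷ u ∷ []

own : Fin 3 → Fin 5
own i = i ↑ˡ 2

-- Corner i has colour i, and the colours 3 and 4 are free. The exceptions light i are those of a vertex x
-- on the triangle together with a vertex on the triangle of x and the two corners other than i. Larger parts leave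
-- at most the exceptions heavy i for some i.
data Kind : Set where
  light heavy : Fin 3 → Kind

-- Origin of `light i`: x takes colour 3 or 4, the second vertex `own i` or the other free colour,
-- which makes four contributions. A target meets all four only if its entry at `i` catches the two
-- with one colour of x while the entries at the two other corners catch one each of the remaining
-- two.
exceptions : Kind → List (Vec Parity 3)
exceptions (light i) =
  place i (set (4F ∷ [])) (set (own i ∷ 3F ∷ [])) (set (3F ∷ 4F ∷ [])) ∷
  place i (set (3F ∷ [])) (set (own i ∷ 4F ∷ [])) (set (3F ∷ 4F ∷ [])) ∷
  place i (set (4F ∷ [])) (set (3F ∷ 4F ∷ [])) (set (own i ∷ 3F ∷ [])) ∷
  place i (set (3F ∷ [])) (set (3F ∷ 4F ∷ [])) (set (own i ∷ 4F ∷ [])) ∷ []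
exceptions (heavy i) =
  place i (set (3F ∷ 4F ∷ [])) (set (own i ∷ 3F ∷ 4F ∷ [])) (set (own (next i) ∷ 3F ∷ 4F ∷ [])) ∷
  place i (set (3F ∷ 4F ∷ [])) (set (own (prev i) ∷ 3F ∷ 4F ∷ [])) (set (own i ∷ 3F ∷ 4F ∷ [])) ∷ []

data Type : Set where
  exact    : Bool → Type
  avoiding : Kind → Type

-- A lone vertex has colour 3 or 4 and is seen once by each corner. The zero contribution is that of
-- an empty part, or of two lone vertices of equal colour.
elements : Bool → List (Vec Parity 3)
elements false = replicate 3 𝟎 ∷ []
elements true  = replicate 3 (unit 3F) ∷ replicate 3 (unit 4F) ∷ []

Avoids : ∀ {n} → Vec Parity n → Vec Parity n → Set
Avoids f t = ∀ i → lookup f i ≢ lookup t i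

-- The reply `f` may depend on the target, since the inside of a part can be coloured after the
-- rest. A part may offer more than its type records, so every type is monotone in `S`.
Has : Type → Pred (Vec Parity 3) 0ℓ → Set
Has (exact b)    S = All S (elements b)
Has (avoiding κ) S = ∀ t → ¬ t ∈ exceptions κ → ∃[ f ] S f × Avoids f t

-- Decision procedures for quantifiers over the finite index types

∀Bool? : ∀ {P : Bool → Set} → Decidable P → Dec (∀ b → P b)
∀Bool? P? = map′ (λ { (f , t) false → f ; (f , t) true → t }) (λ h → h false , h true) (P? false ×-dec P? true)

∀Kind? : ∀ {P : Kind → Set} → Decidable P → Dec (∀ κ → P κ)
∀Kind? P? = map′ (λ { (f , g) (light i) → f i ; (f , g) (heavy i) → g i }) (λ h → h ∘ light , h ∘ heavy)
  (all? (P? ∘ light) ×-dec all? (P? ∘ heavy))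

kinds : List Kind
kinds = List.map light (List.allFin 3) ++ List.map heavy (List.allFin 3)

null? : ∀ {A : Set} (xs : List A) → Dec (xs ≡ [])
null? []      = yes refl
null? (_ ∷ _) = no λ ()

_≟³_ : (t u : Vec Parity 3) → Dec (t ≡ u)
_≟³_ = ≡-dec _≟ᵖ_

open DecMembership _≟³_ using () renaming (_∈?_ to _∈³?_)

-- Sums

_⊕ₛ_ : Pred (Vec Parity 3) 0ℓ → Pred (Vec Parity 3) 0ℓ → Pred (Vec Parity 3) 0ℓ
(S ⊕ₛ S′) v = ∃₂ λ f g → S f × S′ g × v ≡ f ⊞ g

equate : ∀ {n} → Vec Parity n → Conjunction n
equate {n} t = List.map (λ i → i , lookup t i) (List.allFin n)

equate-solves : ∀ {n} (t u : Vec Parity n) → (∀ i → lookup t i ≡ lookup u i) → Solves t (equate u)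
equate-solves t u eq = map⁺ (All.tabulate (λ {i} _ → eq i))

shiftClause : Kind → Vec Parity 3 → Clause 3
shiftClause κ o = List.map (λ b → equate (b ⊞ o)) (exceptions κ)

-- Of the sum of two lone vertices only the cancellation for equal colours is kept. An avoiding part
-- plus a nonzero part answers every target, so the kind of either summand is a valid bound.
sumType : Type → Type → Type
sumType (exact false)   τ                = τ
sumType τ               (exact false)    = τ
sumType (exact true)    (exact true)     = exact false
sumType (exact true)    (avoiding κ)     = avoiding κ
sumType (avoiding κ)    _                = avoiding κ

-- A first summand that avoids t ⊞ o, where o is a cover, leaves to the second summand a target that is no exception.
covers : Kind → List (Vec Parity 3)
covers (light i) = List.map (λ v → place i v (set (3F ∷ 4F ∷ [])) (set (3F ∷ 4F ∷ []))) (𝟎 ∷ List.map unit (List.allFin 5))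
covers (heavy i) = List.map (λ v → place i (set (3F ∷ 4F ∷ [])) v v) (𝟎 ∷ List.map unit (List.allFin 5))

opaque
  covers-cover : ∀ κ → All (λ o → All (λ b → ∃[ i ] lookup b i ≡ lookup o i) (exceptions κ)) (covers κ)
  covers-cover = from-yes (∀Kind? λ κ → All.all? (λ o → All.all? (λ b → any? λ i → lookup b i ≟ᵖ lookup o i) (exceptions κ)) (covers κ))

  -- Two exceptions of one kind never differ by the colours 3 and 4 at all three corners, so one of
  -- the two colours of a lone vertex is safe.
  units-shift : ∀ κ → solutions [] (List.map (shiftClause κ) (elements true)) ≡ []
  units-shift = from-yes (∀Kind? λ κ → null? (solutions [] (List.map (shiftClause κ) (elements true))))

  -- The six covers give six different translates of a target, more than the at most four exceptions
  -- of a kind.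
  covers-shift : ∀ κ κ′ → solutions [] (List.map (shiftClause κ) (covers κ′)) ≡ []
  covers-shift = from-yes (∀Kind? λ κ → ∀Kind? λ κ′ → null? (solutions [] (List.map (shiftClause κ) (covers κ′))))

shifted : ∀ κ os t → solutions [] (List.map (shiftClause κ) os) ≡ [] →
  ∃[ o ] o ∈ os × ¬ (t ⊞ o) ∈ exceptions κ
shifted κ os t none with violated t (shiftClause κ) os [] (¬Any[] none)
... | o , o∈os , ¬b = o , o∈os , λ t⊞o∈ → ¬b (Anyₚ.map⁺ (Any.map solve t⊞o∈))
  where
  solve : ∀ {b} → t ⊞ o ≡ b → Solves t (equate (b ⊞ o))
  solve {b} eq = equate-solves t (b ⊞ o) λ i → trans
    (⊕-moveʳ (lookup o i) (trans (sym (lookup-⊞ i t o)) (cong (λ v → lookup v i) eq)))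
    (sym (lookup-⊞ i b o))

Avoids-⊞ : ∀ {n} (f g t : Vec Parity n) → Avoids g (t ⊞ f) → Avoids (f ⊞ g) t
Avoids-⊞ f g t avoid i eq = avoid i (trans (⊕-moveˡ (lookup f i) (trans (sym (lookup-⊞ i f g)) eq)) (sym (lookup-⊞ i t f)))

⊞-identityˡ : ∀ {n} (v : Vec Parity n) → replicate n 𝟎 ⊞ v ≡ v
⊞-identityˡ = zipWith-identityˡ ⊕-identityˡ

Has-mono : ∀ τ {S S′ : Pred (Vec Parity 3) 0ℓ} → (∀ {v} → S v → S′ v) → Has τ S → Has τ S′
Has-mono (exact b)    sub h = All.map sub h
Has-mono (avoiding κ) sub h t t∉ with h t t∉
... | f , f∈S , avoid = f , sub f∈S , avoid

⊕ₛ-zeroˡ : ∀ {S S′ v} → S (replicate 3 𝟎) → S′ v → (S ⊕ₛ S′) v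
⊕ₛ-zeroˡ z s = _ , _ , z , s , sym (⊞-identityˡ _)

⊕ₛ-comm : ∀ {S S′ v} → (S ⊕ₛ S′) v → (S′ ⊕ₛ S) v
⊕ₛ-comm (f , g , Sf , S′g , eq) = g , f , S′g , Sf , trans eq (⊞-comm f g)

exact-avoiding : ∀ κ {S S′} → Has (exact true) S → Has (avoiding κ) S′ → Has (avoiding κ) (S ⊕ₛ S′)
exact-avoiding κ hS hS′ t _ with shifted κ (elements true) t (units-shift κ)
... | f , f∈ , t⊞f∉ with hS′ (t ⊞ f) t⊞f∉
...   | g , S′g , avoid = f ⊞ g , (f , g , All.lookup hS f∈ , S′g , refl) , Avoids-⊞ f g t avoid

avoiding-avoiding : ∀ κ κ′ {S S′} → Has (avoiding κ) S → Has (avoiding κ′) S′ → Has (avoiding κ) (S ⊕ₛ S′)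
avoiding-avoiding κ κ′ hS hS′ t _ with shifted κ (covers κ′) t (covers-shift κ κ′)
... | o , o∈ , t⊞o∉ with hS (t ⊞ o) t⊞o∉
...   | f , Sf , avoid with hS′ (t ⊞ f) t⊞f∉
  where
  t⊞f∉ : ¬ (t ⊞ f) ∈ exceptions κ′
  t⊞f∉ t⊞f∈ with All.lookup (All.lookup (covers-cover κ′) o∈) t⊞f∈
  ... | i , eq = avoid i (trans
    (⊕-moveˡ (lookup t i) (trans (sym (lookup-⊞ i t f)) eq))
    (trans (⊕-comm (lookup o i) (lookup t i)) (sym (lookup-⊞ i t o))))
...     | g , S′g , avoid′ = f ⊞ g , (f , g , Sf , S′g , refl) , Avoids-⊞ f g t avoid′

Has-⊕ₛ : ∀ τ τ′ {S S′} → Has τ S → Has τ′ S′ → Has (sumType τ τ′) (S ⊕ₛ S′)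
Has-⊕ₛ (exact false) τ′ {S} (z ∷ _) h = Has-mono τ′ (⊕ₛ-zeroˡ {S} z) h
Has-⊕ₛ (exact true) (exact false) {S} {S′} h (z ∷ _) = Has-mono (exact true) (λ s → ⊕ₛ-comm {S′} {S} (⊕ₛ-zeroˡ {S′} z s)) h
Has-⊕ₛ (exact true) (exact true) (u ∷ _) (u′ ∷ _) = (_ , _ , u , u′ , refl) ∷ []
Has-⊕ₛ (exact true) (avoiding κ) = exact-avoiding κ
Has-⊕ₛ (avoiding κ) (exact false) {S} {S′} h (z ∷ _) = Has-mono (avoiding κ) (λ s → ⊕ₛ-comm {S′} {S} (⊕ₛ-zeroˡ {S′} z s)) h
Has-⊕ₛ (avoiding κ) (exact true) {S} {S′} h h′ = Has-mono (avoiding κ) (⊕ₛ-comm {S′} {S}) (exact-avoiding κ h′ h)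
Has-⊕ₛ (avoiding κ) (avoiding κ′) = avoiding-avoiding κ κ′

-- The three triangles at a new vertex

-- The corners 0, 1, 2 of a triangle and a new vertex 3 span a K₄; slot k is its triangle that misses vertex k.
-- Corner i has colour i and vertex 3 gets colour 3 or, if s is true, colour 4.
slotFrame : Fin 3 → Bool → Permutation′ 5
slotFrame k s = insert 3F (inject₁ (inject₁ k)) idₚ ∘ₚ (if s then transpose 3F 4F else idₚ)

-- Inside slot `k` the free colours 3 and 4 stand for the colour of the missed corner `k` and for
-- the one of 3, 4 that the new vertex does not have.
embed : Fin 3 → Bool → Vec Parity 3 → Vec Parity 4
embed k s f = insertAt (Vec.map (push (slotFrame k s)) f) (inject₁ k) 𝟎

newColour : Bool → Fin 5
newColour s = if s then 4F else 3F

-- The edges from the new vertex to the corners. Its own entry is zero, because what it sees of them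
-- is the separate constant `parents`.
offset : Bool → Vec Parity 4
offset s = unit (newColour s) ∷ unit (newColour s) ∷ unit (newColour s) ∷ 𝟎 ∷ []

total : Bool → (f₀ f₁ f₂ : Vec Parity 3) → Vec Parity 4
total s f₀ f₁ f₂ = offset s ⊞ (embed 0F s f₀ ⊞ (embed 1F s f₁ ⊞ embed 2F s f₂))

parents : Parity
parents = set (0F ∷ 1F ∷ 2F ∷ [])

Slots : Set₁
Slots = Fin 3 → Bool → Pred (Vec Parity 3) 0ℓ

-- The parity vector of the new vertex is its total contribution plus the one of its three earlier neighbours.
Node : Slots → Pred (Vec Parity 3) 0ℓ
Node S v = ∃[ s ] ∃[ f₀ ] ∃[ f₁ ] ∃[ f₂ ]
  (S 0F s f₀ × S 1F s f₁ × S 2F s f₂) ×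
  (∀ i → lookup (total s f₀ f₁ f₂) (inject₁ i) ≡ lookup v i) ×
  lookup (total s f₀ f₁ f₂) 3F ≢ parents

-- With this fourth entry, answering `t` and satisfying the new vertex become a single avoidance
-- problem on the K₄.
target : Vec Parity 3 → Vec Parity 4
target (a ∷ b ∷ c ∷ []) = a ∷ b ∷ c ∷ parents ∷ []

lookup-extend : ∀ t i → lookup (target t) (inject₁ i) ≡ lookup t i
lookup-extend (_ ∷ _ ∷ _ ∷ []) 0F = refl
lookup-extend (_ ∷ _ ∷ _ ∷ []) 1F = refl
lookup-extend (_ ∷ _ ∷ _ ∷ []) 2F = refl

lookup-extend-3 : ∀ t → lookup (target t) 3F ≡ parents
lookup-extend-3 (_ ∷ _ ∷ _ ∷ []) = refl

Combination : Slots → Vec Parity 4 → Set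
Combination S w = ∃[ s ] ∃[ f₀ ] ∃[ f₁ ] ∃[ f₂ ]
  (S 0F s f₀ × S 1F s f₁ × S 2F s f₂) × w ≡ total s f₀ f₁ f₂

node-avoids : ∀ S t w → Combination S w → Avoids w (target t) → ∃[ f ] Node S f × Avoids f t
node-avoids S t w@(a ∷ b ∷ c ∷ _ ∷ []) (s , f₀ , f₁ , f₂ , Sf , eq) avoid =
  v , (s , f₀ , f₁ , f₂ , Sf , (λ i → trans (at (inject₁ i)) (same i)) ,
    λ e → avoid 3F (trans (sym (at 3F)) (trans e (sym (lookup-extend-3 t))))) ,
  λ i e → avoid (inject₁ i) (trans (same i) (trans e (sym (lookup-extend t i))))
  where
  v : Vec Parity 3
  v = a ∷ b ∷ c ∷ []
  at : ∀ i → lookup (total s f₀ f₁ f₂) i ≡ lookup w i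
  at i = cong (λ w → lookup w i) (sym eq)
  same : ∀ i → lookup w (inject₁ i) ≡ lookup v i
  same 0F = refl
  same 1F = refl
  same 2F = refl

combine : ∀ S k s u v w → S k s u → S (next k) s v → S (prev k) s w →
  Combination S (offset s ⊞ (embed k s u ⊞ (embed (next k) s v ⊞ embed (prev k) s w)))
combine S 0F s u v w Su Sv Sw = s , u , v , w , (Su , Sv , Sw) , refl
combine S 1F s u v w Su Sv Sw = s , w , u , v , (Sw , Su , Sv) ,
  cong (offset s ⊞_) (trans (sym (⊞-assoc (embed 1F s u) (embed 2F s v) (embed 0F s w)))
    (⊞-comm (embed 1F s u ⊞ embed 2F s v) (embed 0F s w)))
combine S 2F s u v w Su Sv Sw = s , v , w , u , (Sv , Sw , Su) ,
  cong (offset s ⊞_) (trans (⊞-comm (embed 2F s u) (embed 0F s v ⊞ embed 1F s w))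
    (⊞-assoc (embed 0F s v) (embed 1F s w) (embed 2F s u)))

lookup-embed : ∀ k s f j → lookup (embed k s f) (punchIn (inject₁ k) j) ≡ push (slotFrame k s) (lookup f j)
lookup-embed k s f j = trans (insertAt-punchIn (Vec.map (push (slotFrame k s)) f) (inject₁ k) 𝟎 j) (lookup-map j _ f)

lookup-embed-missing : ∀ k s f → lookup (embed k s f) (inject₁ k) ≡ 𝟎
lookup-embed-missing k s f = insertAt-lookup (Vec.map (push (slotFrame k s)) f) (inject₁ k) 𝟎

restrict : Fin 3 → Bool → Vec Parity 4 → Vec Parity 3
restrict k s w = tabulate λ j → push (flip (slotFrame k s)) (lookup w (punchIn (inject₁ k) j))

lookup-restrict : ∀ k s w j → lookup (restrict k s w) j ≡ push (flip (slotFrame k s)) (lookup w (punchIn (inject₁ k) j))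
lookup-restrict k s w j = lookup∘tabulate (λ j → push (flip (slotFrame k s)) (lookup w (punchIn (inject₁ k) j))) j

embed-restrict : ∀ k s w i → inject₁ k ≢ i → lookup (embed k s (restrict k s w)) i ≡ lookup w i
embed-restrict k s w i k≢i = subst (λ i → lookup (embed k s (restrict k s w)) i ≡ lookup w i) (punchIn-punchOut k≢i) (begin
  lookup (embed k s (restrict k s w)) (punchIn (inject₁ k) j)  ≡⟨ lookup-embed k s (restrict k s w) j ⟩
  push (slotFrame k s) (lookup (restrict k s w) j)             ≡⟨ cong (push (slotFrame k s)) (lookup-restrict k s w j) ⟩
  push (slotFrame k s) (push (flip (slotFrame k s)) (lookup w (punchIn (inject₁ k) j)))
                                                               ≡⟨ push-flip (slotFrame k s) _ ⟩
  lookup w (punchIn (inject₁ k) j)                             ∎)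
  where
  open ≡-Reasoning
  j = punchOut k≢i

lookup-embed⁻ : ∀ k s f {i} (k≢i : inject₁ k ≢ i) → lookup f (punchOut k≢i) ≡ push (flip (slotFrame k s)) (lookup (embed k s f) i)
lookup-embed⁻ k s f {i} k≢i = begin
  lookup f j                          ≡⟨ push-flip (flip π) (lookup f j) ⟨
  push (flip π) (push π (lookup f j)) ≡⟨ cong (push (flip π)) (lookup-embed k s f j) ⟨
  push (flip π) (lookup (embed k s f) (punchIn (inject₁ k) j))
                                      ≡⟨ cong (λ l → push (flip π) (lookup (embed k s f) l)) (punchIn-punchOut k≢i) ⟩
  push (flip π) (lookup (embed k s f) i) ∎
  where
  open ≡-Reasoning
  j = punchOut k≢i
  π = slotFrame k s

-- A part in slot `k` has no influence on vertex `k`, so only the other three entries of `w` are at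
-- stake. Pulled back along the frame they form an ordinary target.
slot-avoid : ∀ κ k s {S} → Has (avoiding κ) S → ∀ w →
  ¬ (∃[ b ] b ∈ exceptions κ × (∀ i → inject₁ k ≢ i → lookup (embed k s b) i ≡ lookup w i)) →
  ∃[ f ] S f × (∀ i → inject₁ k ≢ i → lookup (embed k s f) i ≢ lookup w i)
slot-avoid κ k s {S} h w none = relabel (h (restrict k s w) (λ r∈ → none (_ , r∈ , embed-restrict k s w)))
  where
  relabel : ∃[ f ] S f × Avoids f (restrict k s w) → ∃[ f ] S f × (∀ i → inject₁ k ≢ i → lookup (embed k s f) i ≢ lookup w i)
  relabel (f , Sf , avoid) = f , Sf , λ i k≢i eq → avoid (punchOut k≢i) (trans (lookup-embed⁻ k s f k≢i)
    (trans (cong (push (flip (slotFrame k s))) (trans eq (cong (lookup w) (sym (punchIn-punchOut k≢i)))))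
      (sym (lookup-restrict k s w (punchOut k≢i)))))

opaque
  exceptions-not-constant : ∀ κ → All (λ b → lookup b 0F ≢ lookup b 1F) (exceptions κ)
  exceptions-not-constant = from-yes (∀Kind? λ κ → All.all? (λ b → ¬? (lookup b 0F ≟ᵖ lookup b 1F)) (exceptions κ))

-- A lone vertex offers two values at each corner. An avoiding part is played against a constant
-- target, which is never an exception since exceptions differ at their first two corners.
avoid-at : ∀ τ → τ ≢ exact false → ∀ {S} → Has τ S → ∀ (j : Fin 3) v → ∃[ f ] S f × lookup f j ≢ v
avoid-at (exact false) τ≢ h j v = contradiction refl τ≢
avoid-at (exact true) τ≢ (u ∷ u′ ∷ []) j v with unit 3F ≟ᵖ v
... | no ≢v    = _ , u , λ eq → ≢v (trans (sym (lookup-replicate j (unit 3F))) eq)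
... | yes refl = _ , u′ , λ eq → contradiction (trans (sym (lookup-replicate j (unit 4F))) eq) λ ()
avoid-at (avoiding κ) τ≢ h j v with h (replicate 3 v) (λ v∈ → All.lookup (exceptions-not-constant κ) v∈ refl)
... | f , Sf , avoid = f , Sf , λ eq → avoid j (trans eq (sym (lookup-replicate j v)))

slot-avoid-at : ∀ τ → τ ≢ exact false → ∀ k s {S} → Has τ S → ∀ {i} → inject₁ k ≢ i → ∀ v →
  ∃[ f ] S f × lookup (embed k s f) i ≢ v
slot-avoid-at τ τ≢ k s h k≢i v with avoid-at τ τ≢ h (punchOut k≢i) (push (flip (slotFrame k s)) v)
... | f , Sf , avoid = f , Sf , λ { refl → avoid (lookup-embed⁻ k s f k≢i) }

-- A syntactic certificate that the branch `σ` pins the target to an exception; such branches may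
-- survive the search.
Confined : Kind → Conjunction 4 → Set
Confined κ σ = Any (λ b → ∀ i → (inject₁ i , lookup b i) ∈ σ) (exceptions κ)

open DecMembership (×-≡-dec (_≟_ {4}) _≟ᵖ_) using () renaming (_∈?_ to _∈ᵉ?_)

confined? : ∀ κ → Decidable (Confined κ)
confined? κ σ = Any.any? (λ b → all? λ i → (inject₁ i , lookup b i) ∈ᵉ? σ) (exceptions κ)

newVertex : Conjunction 4
newVertex = (3F , parents) ∷ []

target-newVertex : ∀ t → Solves (target t) newVertex
target-newVertex t = lookup-extend-3 t ∷ []

confined-sound : ∀ κ {σ} t → Solves (target t) σ → Confined κ σ → t ∈ exceptions κ
confined-sound κ t sol = Any.map λ forced → lookup-ext _ _ λ i →
  trans (sym (lookup-extend t i)) (All.lookup sol (forced i))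

violated-extend : ∀ {A : Set} (clause : A → Clause 4) xs κ → All (Confined κ) (solutions newVertex (List.map clause xs)) →
  ∀ t → ¬ t ∈ exceptions κ → ∃[ x ] x ∈ xs × ¬ Any (Solves (target t)) (clause x)
violated-extend clause xs κ confined t t∉ = violated (target t) clause xs (target-newVertex t) none
  where
  none : ¬ Any (Solves (target t)) (solutions newVertex (List.map clause xs))
  none some with find some
  ... | σ , σ∈ , sol = t∉ (confined-sound κ t sol (All.lookup confined σ∈))

bools : List Bool
bools = false ∷ true ∷ []

-- No slot is known only by its exceptions

ExactChoice : Set
ExactChoice = Bool × Vec Parity 3 × Vec Parity 3 × Vec Parity 3

exactChoices : Bool → Bool → Bool → List ExactChoice
exactChoices b₀ b₁ b₂ =
  cartesianProduct bools (cartesianProduct (elements b₀) (cartesianProduct (elements b₁) (elements b₂)))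

exactClause : ExactChoice → Clause 4
exactClause (s , f₀ , f₁ , f₂) = List.map (λ i → (i , lookup (total s f₀ f₁ f₂) i) ∷ []) (List.allFin 4)

opaque
  exact-confined : ∀ b₀ b₁ b₂ → b₀ ∨ b₁ ∨ b₂ ≡ true →
    Any (λ κ → All (Confined κ) (solutions newVertex (List.map exactClause (exactChoices b₀ b₁ b₂)))) kinds
  exact-confined = from-yes (∀Bool? λ b₀ → ∀Bool? λ b₁ → ∀Bool? λ b₂ → (b₀ ∨ b₁ ∨ b₂ ≟ᵇ true) →-dec
    Any.any? (λ κ → All.all? (confined? κ) (solutions newVertex (List.map exactClause (exactChoices b₀ b₁ b₂)))) kinds)

-- The resulting type is fixed before the sets are given, hence is the same for all colourings of
-- the triangle, as `Good` demands. Naming the slots in cyclic order from `k` lets the special slot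
-- come first.
NodeHasAt : Fin 3 → Type → Type → Type → Set₁
NodeHasAt k τ₀ τ₁ τ₂ = ∃[ τ ] ∀ (S : Slots) →
  (∀ s → Has τ₀ (S k s)) → (∀ s → Has τ₁ (S (next k) s)) → (∀ s → Has τ₂ (S (prev k) s)) → Has τ (Node S)

exact-choice : ∀ S t s f₀ f₁ f₂ → S 0F s f₀ × S 1F s f₁ × S 2F s f₂ →
  ¬ Any (Solves (target t)) (exactClause (s , f₀ , f₁ , f₂)) → ∃[ f ] Node S f × Avoids f t
exact-choice S t s f₀ f₁ f₂ Sf ¬sol = node-avoids S t (total s f₀ f₁ f₂) (s , f₀ , f₁ , f₂ , Sf , refl)
  λ i eq → ¬sol (Anyₚ.map⁺ {f = λ i → (i , lookup (total s f₀ f₁ f₂) i) ∷ []} (lose (∈-allFin i) (sym eq ∷ [])))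

node-exact : ∀ b₀ b₁ b₂ → b₀ ∨ b₁ ∨ b₂ ≡ true → NodeHasAt 0F (exact b₀) (exact b₁) (exact b₂)
node-exact b₀ b₁ b₂ some = avoiding κ , has
  where
  found = find (exact-confined b₀ b₁ b₂ some)
  κ = proj₁ found
  confined = proj₂ (proj₂ found)
  has : ∀ S → (∀ s → Has (exact b₀) (S 0F s)) → (∀ s → Has (exact b₁) (S 1F s)) → (∀ s → Has (exact b₂) (S 2F s)) →
    Has (avoiding κ) (Node S)
  has S h₀ h₁ h₂ t t∉ = choose (violated-extend exactClause (exactChoices b₀ b₁ b₂) κ confined t t∉)
    where
    choose : ∃[ o ] o ∈ exactChoices b₀ b₁ b₂ × ¬ Any (Solves (target t)) (exactClause o) → ∃[ f ] Node S f × Avoids f t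
    choose ((s , f₀ , f₁ , f₂) , o∈ , ¬sol) =
      let f₀∈ , f₁₂∈ = ∈-cartesianProduct⁻ (elements b₀) (cartesianProduct (elements b₁) (elements b₂))
                         (proj₂ (∈-cartesianProduct⁻ bools _ o∈))
          f₁∈ , f₂∈ = ∈-cartesianProduct⁻ (elements b₁) (elements b₂) f₁₂∈
      in exact-choice S t s f₀ f₁ f₂ (All.lookup (h₀ s) f₀∈ , All.lookup (h₁ s) f₁∈ , All.lookup (h₂ s) f₂∈) ¬sol

node-empty : NodeHasAt 0F (exact false) (exact false) (exact false)
node-empty = exact true , λ S h₀ h₁ h₂ → leaf S h₀ h₁ h₂ false ∷ leaf S h₀ h₁ h₂ true ∷ []
  where
  leaf : ∀ (S : Slots) → (∀ s → Has (exact false) (S 0F s)) → (∀ s → Has (exact false) (S 1F s)) →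
    (∀ s → Has (exact false) (S 2F s)) → ∀ s → Node S (replicate 3 (unit (newColour s)))
  leaf S h₀ h₁ h₂ s = s , replicate 3 𝟎 , replicate 3 𝟎 , replicate 3 𝟎 ,
    (All.head (h₀ s) , All.head (h₁ s) , All.head (h₂ s)) , leaf-total s , leaf-new s
    where
    leaf-total : ∀ s i → lookup (total s (replicate 3 𝟎) (replicate 3 𝟎) (replicate 3 𝟎)) (inject₁ i) ≡ lookup (replicate 3 (unit (newColour s))) i
    leaf-total false 0F = refl
    leaf-total false 1F = refl
    leaf-total false 2F = refl
    leaf-total true  0F = refl
    leaf-total true  1F = refl
    leaf-total true  2F = refl
    leaf-new : ∀ s → lookup (total s (replicate 3 𝟎) (replicate 3 𝟎) (replicate 3 𝟎)) 3F ≢ parents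
    leaf-new false ()
    leaf-new true  ()

-- One slot is known only by its exceptions

Choice : Set
Choice = Bool × Vec Parity 3 × Vec Parity 3

choices : Bool → Bool → List Choice
choices b b′ = cartesianProduct bools (cartesianProduct (elements b) (elements b′))

known : Fin 3 → Choice → Vec Parity 4
known k (s , f , g) = offset s ⊞ (embed (next k) s f ⊞ embed (prev k) s g)

equateSlot : Fin 3 → Vec Parity 4 → Conjunction 4
equateSlot k w = List.map (λ j → punchIn (inject₁ k) j , lookup w (punchIn (inject₁ k) j)) (List.allFin 3)

equateSlot-solves : ∀ k (t w : Vec Parity 4) → (∀ i → inject₁ k ≢ i → lookup t i ≡ lookup w i) → Solves t (equateSlot k w)
equateSlot-solves k t w eq = map⁺ (All.tabulate λ {j} _ → eq _ (punchInᵢ≢i (inject₁ k) j ∘ sym))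

-- A choice for the rest fails in two ways: it already hits the target at `k`, where slot `k` cannot
-- help, or it leaves an exception to slot `k`.
slotClause : Fin 3 → Kind → Choice → Clause 4
slotClause k κ o@(s , _) =
  ((inject₁ k , lookup (known k o) (inject₁ k)) ∷ []) ∷
  List.map (λ b → equateSlot k (embed k s b ⊞ known k o)) (exceptions κ)

opaque
  slot-confined : ∀ k κ b b′ →
    Any (λ κ′ → All (Confined κ′) (solutions newVertex (List.map (slotClause k κ) (choices b b′)))) kinds
  slot-confined = from-yes (all? λ k → ∀Kind? λ κ → ∀Bool? λ b → ∀Bool? λ b′ →
    Any.any? (λ κ′ → All.all? (confined? κ′) (solutions newVertex (List.map (slotClause k κ) (choices b b′)))) kinds)

slot-choice : ∀ S k κ o → Has (avoiding κ) (S k (proj₁ o)) →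
  S (next k) (proj₁ o) (proj₁ (proj₂ o)) → S (prev k) (proj₁ o) (proj₂ (proj₂ o)) →
  ∀ t → ¬ Any (Solves (target t)) (slotClause k κ o) → ∃[ f ] Node S f × Avoids f t
slot-choice S k κ o@(s , g , g′) h Sg Sg′ t ¬sol = finish (slot-avoid κ k s h (T ⊞ u) none)
  where
  T u : Vec Parity 4
  T = target t
  u = known k o
  none : ¬ (∃[ b ] b ∈ exceptions κ × (∀ i → inject₁ k ≢ i → lookup (embed k s b) i ≡ lookup (T ⊞ u) i))
  none (b , b∈ , eq) = ¬sol (there (Anyₚ.map⁺ (lose b∈ (equateSlot-solves k T (embed k s b ⊞ u) λ i k≢i →
    trans (⊕-moveʳ (lookup u i) (sym (trans (eq i k≢i) (lookup-⊞ i T u)))) (sym (lookup-⊞ i (embed k s b) u))))))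
  finish : ∃[ f ] S k s f × (∀ i → inject₁ k ≢ i → lookup (embed k s f) i ≢ lookup (T ⊞ u) i) → ∃[ f ] Node S f × Avoids f t
  finish (f , Sf , avoid) = node-avoids S t _ (combine S k s f g g′ Sf Sg Sg′) avoids
    where
    r : Vec Parity 4
    r = embed (next k) s g ⊞ embed (prev k) s g′
    rearrange : offset s ⊞ (embed k s f ⊞ r) ≡ embed k s f ⊞ u
    rearrange = trans (sym (⊞-assoc (offset s) (embed k s f) r))
      (trans (cong (_⊞ r) (⊞-comm (offset s) (embed k s f))) (⊞-assoc (embed k s f) (offset s) r))
    at : ∀ i → lookup (offset s ⊞ (embed k s f ⊞ r)) i ≡ lookup (embed k s f) i ⊕ lookup u i
    at i = trans (cong (λ w → lookup w i) rearrange) (lookup-⊞ i (embed k s f) u)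
    avoids : Avoids (offset s ⊞ (embed k s f ⊞ r)) T
    avoids i eq with inject₁ k ≟ i
    ... | yes refl = ¬sol (here (trans (sym eq) (trans (at i)
      (trans (cong (_⊕ lookup u i) (lookup-embed-missing k s f)) (⊕-identityˡ (lookup u i)))) ∷ []))
    ... | no k≢i = avoid i k≢i (trans (⊕-moveʳ (lookup u i) (trans (sym (at i)) eq)) (sym (lookup-⊞ i T u)))

node-one : ∀ k κ b b′ → NodeHasAt k (avoiding κ) (exact b) (exact b′)
node-one k κ b b′ = avoiding κ′ , has
  where
  found = find (slot-confined k κ b b′)
  κ′ = proj₁ found
  confined = proj₂ (proj₂ found)
  has : ∀ (S : Slots) → (∀ s → Has (avoiding κ) (S k s)) →
    (∀ s → Has (exact b) (S (next k) s)) → (∀ s → Has (exact b′) (S (prev k) s)) → Has (avoiding κ′) (Node S)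
  has S h h′ h″ t t∉ = choose (violated-extend (slotClause k κ) (choices b b′) κ′ confined t t∉)
    where
    choose : ∃[ o ] o ∈ choices b b′ × ¬ Any (Solves (target t)) (slotClause k κ o) → ∃[ f ] Node S f × Avoids f t
    choose (o@(s , g , g′) , o∈ , ¬sol) =
      let g∈ , g′∈ = ∈-cartesianProduct⁻ (elements b) (elements b′) (proj₂ (∈-cartesianProduct⁻ bools _ o∈))
      in slot-choice S k κ o (h s) (All.lookup (h′ s) g∈) (All.lookup (h″ s) g′∈) t ¬sol

-- Two slots are known only by their exceptions

Block : Set
Block = Parity × Parity

-- The slots next k and prev k share the vertices k and 3. The contribution to the slot prev k is chosen
-- so as to miss r at 3 and d at k, up to the target there; only exceptions of the slot next k
-- that agree with r at 3 or with d at k can then coincide with what remains.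
blocks : Fin 3 → Kind → List Block
blocks k κ = List.map (λ (b , b′) → lookup (embed (next k) false b) 3F , lookup (embed (next k) false b′) (inject₁ k))
  (cartesianProduct (exceptions κ) (exceptions κ))

-- What remains for slot `next k` differs from `r` at 3 and from `d` at `k`. An exception with
-- either of these values is thereby excluded, and the ones kept here are still possible.
unblocked? : ∀ k → ((r , d) : Block) → Decidable (λ b →
  lookup (embed (next k) false b) 3F ≢ r × lookup (embed (next k) false b) (inject₁ k) ≢ d)
unblocked? k (r , d) b =
  ¬? (lookup (embed (next k) false b) 3F ≟ᵖ r) ×-dec ¬? (lookup (embed (next k) false b) (inject₁ k) ≟ᵖ d)

remainingEquation : Fin 3 → Vec Parity 3 → Conjunction 4
remainingEquation k b = (inject₁ (prev k) , lookup (embed (next k) false b) (inject₁ (prev k))) ∷ []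

blockedEquations : Fin 3 → Block → Vec Parity 3 → Conjunction 4
blockedEquations k (r , d) b =
  (3F , lookup (embed (prev k) false b) 3F ⊕ r) ∷
  (inject₁ k , lookup (embed (prev k) false b) (inject₁ k) ⊕ d) ∷
  (inject₁ (next k) , lookup (embed (prev k) false b) (inject₁ (next k))) ∷ []

-- Slot `prev k` misses the vertex `prev k`, so the entry there does not depend on the first reply,
-- and an unblocked exception turns into an equation on the target alone. The other disjuncts say
-- that the first reply meets an exception.
blockClause : Fin 3 → Kind → Kind → Block → Clause 4
blockClause k κ κ′ o =
  List.map (remainingEquation k) (List.filter (unblocked? k o) (exceptions κ)) ++
  List.map (blockedEquations k o) (exceptions κ′)

blockClauses : Fin 3 → Kind → Kind → List (Clause 4)
blockClauses k κ κ′ = List.map (blockClause k κ κ′) (blocks k κ)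

-- If all blocks fail, the target has a forced value at vertex prev k, from which a nonzero part in the slot k can
-- steer away. The candidate 𝟎 serves the case that the blocks never fail together.
candidates : Fin 3 → Kind → List Parity
candidates k κ = 𝟎 ∷ List.map (λ b → lookup (embed (next k) false b) (inject₁ (prev k))) (exceptions κ)

opaque
  -- For a zero contribution in slot `k` the value at 3 is known, and this equation makes the
  -- failures of all blocks incompatible.
  blocks-new : ∀ k κ κ′ → solutions newVertex (blockClauses k κ κ′) ≡ []
  blocks-new = from-yes (all? λ k → ∀Kind? λ κ → ∀Kind? λ κ′ → null? (solutions newVertex (blockClauses k κ κ′)))

  blocks-forced : ∀ k κ κ′ →
    Any (λ v → All ((inject₁ (prev k) , v) ∈_) (solutions [] (blockClauses k κ κ′))) (candidates k κ)
  blocks-forced = from-yes (all? λ k → ∀Kind? λ κ → ∀Kind? λ κ′ →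
    Any.any? (λ v → All.all? (λ σ → (inject₁ (prev k) , v) ∈ᵉ? σ) (solutions [] (blockClauses k κ κ′))) (candidates k κ))

  vertices : ∀ k i → i ≡ 3F ⊎ i ≡ inject₁ k ⊎ i ≡ inject₁ (next k) ⊎ i ≡ inject₁ (prev k)
  vertices = from-yes (all? λ k → all? λ i →
    (i ≟ 3F) ⊎-dec (i ≟ inject₁ k) ⊎-dec (i ≟ inject₁ (next k)) ⊎-dec (i ≟ inject₁ (prev k)))

  next≢3 : ∀ k → inject₁ (next k) ≢ 3F
  next≢3 = from-yes (all? λ k → ¬? (inject₁ (next k) ≟ 3F))

  next≢ : ∀ k → inject₁ (next k) ≢ inject₁ k
  next≢ = from-yes (all? λ k → ¬? (inject₁ (next k) ≟ inject₁ k))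

  next≢prev : ∀ k → inject₁ (next k) ≢ inject₁ (prev k)
  next≢prev = from-yes (all? λ k → ¬? (inject₁ (next k) ≟ inject₁ (prev k)))

  prev≢3 : ∀ k → inject₁ (prev k) ≢ 3F
  prev≢3 = from-yes (all? λ k → ¬? (inject₁ (prev k) ≟ 3F))

  prev≢ : ∀ k → inject₁ (prev k) ≢ inject₁ k
  prev≢ = from-yes (all? λ k → ¬? (inject₁ (prev k) ≟ inject₁ k))

blockVector : Fin 3 → Block → Vec Parity 4
blockVector k (r , d) = (replicate 4 𝟎 Vec.[ 3F ]≔ r) Vec.[ inject₁ k ]≔ d

blockVector-3 : ∀ k r d → lookup (blockVector k (r , d)) 3F ≡ r
blockVector-3 0F r d = refl
blockVector-3 1F r d = refl
blockVector-3 2F r d = refl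

blockVector-k : ∀ k r d → lookup (blockVector k (r , d)) (inject₁ k) ≡ d
blockVector-k 0F r d = refl
blockVector-k 1F r d = refl
blockVector-k 2F r d = refl

blockVector-next : ∀ k r d → lookup (blockVector k (r , d)) (inject₁ (next k)) ≡ 𝟎
blockVector-next 0F r d = refl
blockVector-next 1F r d = refl
blockVector-next 2F r d = refl

block-choice : ∀ k κ κ′ {S S′} → Has (avoiding κ) S → Has (avoiding κ′) S′ → ∀ w o →
  ¬ Any (Solves w) (blockClause k κ κ′ o) →
  ∃₂ λ f g → S f × S′ g × Avoids (embed (next k) false f ⊞ embed (prev k) false g) w
block-choice k κ κ′ {S} {S′} h h′ w o@(r , d) ¬sol = first (slot-avoid κ′ (prev k) false h′ (w ⊞ x) none)
  where
  x : Vec Parity 4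
  x = blockVector k o
  none : ¬ (∃[ b ] b ∈ exceptions κ′ × (∀ i → inject₁ (prev k) ≢ i → lookup (embed (prev k) false b) i ≡ lookup (w ⊞ x) i))
  none (b , b∈ , eq) = ¬sol (Anyₚ.++⁺ʳ _ (Anyₚ.map⁺ (lose b∈
    (solve 3F (prev≢3 k) (blockVector-3 k r d) ∷ solve (inject₁ k) (prev≢ k) (blockVector-k k r d) ∷
     trans (solve (inject₁ (next k)) (λ eq → next≢prev k (sym eq)) (blockVector-next k r d)) (⊕-identityʳ _) ∷ []))))
    where
    solve : ∀ i {v} → inject₁ (prev k) ≢ i → lookup x i ≡ v → lookup w i ≡ lookup (embed (prev k) false b) i ⊕ v
    solve i ≢i refl = ⊕-moveʳ (lookup x i) (sym (trans (eq i ≢i) (lookup-⊞ i w x)))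
  first : ∃[ g ] S′ g × (∀ i → inject₁ (prev k) ≢ i → lookup (embed (prev k) false g) i ≢ lookup (w ⊞ x) i) →
    ∃₂ λ f g → S f × S′ g × Avoids (embed (next k) false f ⊞ embed (prev k) false g) w
  first (g , S′g , avoid) = second (slot-avoid κ (next k) false h (w ⊞ y) none′)
    where
    y : Vec Parity 4
    y = embed (prev k) false g
    misses : ∀ i {v} → inject₁ (prev k) ≢ i → lookup x i ≡ v → lookup (w ⊞ y) i ≢ v
    misses i ≢i refl eq = avoid i ≢i (trans (⊕-moveˡ (lookup w i) (trans (sym (lookup-⊞ i w y)) eq))
      (trans (⊕-comm (lookup x i) (lookup w i)) (sym (lookup-⊞ i w x))))
    none′ : ¬ (∃[ b ] b ∈ exceptions κ × (∀ i → inject₁ (next k) ≢ i → lookup (embed (next k) false b) i ≡ lookup (w ⊞ y) i))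
    none′ (b , b∈ , eq) = ¬sol (Anyₚ.++⁺ˡ (Anyₚ.map⁺ (lose
      (∈-filter⁺ (unblocked? k o) b∈
        ((λ e → misses 3F (prev≢3 k) (blockVector-3 k r d) (trans (sym (eq 3F (next≢3 k))) e)) ,
         (λ e → misses (inject₁ k) (prev≢ k) (blockVector-k k r d) (trans (sym (eq (inject₁ k) (next≢ k))) e))))
      (sym (trans (eq a (next≢prev k)) (trans (lookup-⊞ a w y)
        (trans (cong (lookup w a ⊕_) (lookup-embed-missing (prev k) false g)) (⊕-identityʳ _)))) ∷ []))))
      where a = inject₁ (prev k)
    second : ∃[ f ] S f × (∀ i → inject₁ (next k) ≢ i → lookup (embed (next k) false f) i ≢ lookup (w ⊞ y) i) →
      ∃₂ λ f g → S f × S′ g × Avoids (embed (next k) false f ⊞ embed (prev k) false g) w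
    second (f , Sf , avoid′) = f , g , Sf , S′g , avoids
      where
      z : Vec Parity 4
      z = embed (next k) false f
      at : ∀ i → inject₁ (next k) ≢ i → lookup (z ⊞ y) i ≢ lookup w i
      at i ≢i eq = avoid′ i ≢i (trans (⊕-moveʳ (lookup y i) (trans (sym (lookup-⊞ i z y)) eq)) (sym (lookup-⊞ i w y)))
      at-next : lookup (z ⊞ y) (inject₁ (next k)) ≢ lookup w (inject₁ (next k))
      at-next eq = avoid c (λ eq → next≢prev k (sym eq)) (begin
        lookup y c                ≡⟨ ⊕-identityˡ _ ⟨
        𝟎 ⊕ lookup y c            ≡⟨ cong (_⊕ lookup y c) (lookup-embed-missing (next k) false f) ⟨
        lookup z c ⊕ lookup y c   ≡⟨ lookup-⊞ c z y ⟨
        lookup (z ⊞ y) c          ≡⟨ eq ⟩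
        lookup w c                ≡⟨ ⊕-identityʳ _ ⟨
        lookup w c ⊕ 𝟎            ≡⟨ cong (lookup w c ⊕_) (blockVector-next k r d) ⟨
        lookup w c ⊕ lookup x c   ≡⟨ lookup-⊞ c w x ⟨
        lookup (w ⊞ x) c          ∎)
        where
        open ≡-Reasoning
        c = inject₁ (next k)
      avoids : Avoids (z ⊞ y) w
      avoids i with vertices k i
      ... | inj₁ refl                 = at _ (next≢3 k)
      ... | inj₂ (inj₁ refl)          = at _ (next≢ k)
      ... | inj₂ (inj₂ (inj₁ refl))   = at-next
      ... | inj₂ (inj₂ (inj₂ refl))   = at _ (next≢prev k)

-- With two avoiding slots colour 3 always suffices for the new vertex, which is why the blocks are
-- stated for `false`.
two-choice : ∀ (S : Slots) k κ κ′ → Has (avoiding κ) (S (next k) false) → Has (avoiding κ′) (S (prev k) false) →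
  ∀ e → S k false e → ∀ t {σ} → Solves (target t ⊞ (offset false ⊞ embed k false e)) σ →
  ¬ Any (Solves (target t ⊞ (offset false ⊞ embed k false e))) (solutions σ (blockClauses k κ κ′)) →
  ∃[ f ] Node S f × Avoids f t
two-choice S k κ κ′ h h′ e Se t sol none = choose (violated w (blockClause k κ κ′) (blocks k κ) sol none)
  where
  u w : Vec Parity 4
  u = offset false ⊞ embed k false e
  w = target t ⊞ u
  finish : (∃₂ λ f g → S (next k) false f × S (prev k) false g × Avoids (embed (next k) false f ⊞ embed (prev k) false g) w) →
    ∃[ f ] Node S f × Avoids f t
  finish (f , g , Sf , Sg , avoid) = node-avoids S t _ (combine S k false e f g Se Sf Sg)
    (subst (λ v → Avoids v (target t)) (⊞-assoc (offset false) (embed k false e) (embed (next k) false f ⊞ embed (prev k) false g))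
      (Avoids-⊞ u (embed (next k) false f ⊞ embed (prev k) false g) (target t) avoid))
  choose : ∃[ o ] o ∈ blocks k κ × ¬ Any (Solves w) (blockClause k κ κ′ o) → ∃[ f ] Node S f × Avoids f t
  choose (o , _ , ¬sol) = finish (block-choice k κ κ′ h h′ w o ¬sol)

node-two-empty : ∀ k κ κ′ (S : Slots) → (∀ s → Has (exact false) (S k s)) → (∀ s → Has (avoiding κ) (S (next k) s)) →
  (∀ s → Has (avoiding κ′) (S (prev k) s)) → Has (avoiding (heavy 0F)) (Node S)
node-two-empty k κ κ′ S h h′ h″ t _ =
  two-choice S k κ κ′ (h′ false) (h″ false) (replicate 3 𝟎) (All.head (h false)) t
    {newVertex} (new k t ∷ []) (¬Any[] (blocks-new k κ κ′))
  where
  new : ∀ k t → lookup (target t ⊞ (offset false ⊞ embed k false (replicate 3 𝟎))) 3F ≡ parents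
  new 0F (_ ∷ _ ∷ _ ∷ []) = refl
  new 1F (_ ∷ _ ∷ _ ∷ []) = refl
  new 2F (_ ∷ _ ∷ _ ∷ []) = refl

node-two-nonempty : ∀ k τ κ κ′ → τ ≢ exact false → (S : Slots) →
  (∀ s → Has τ (S k s)) → (∀ s → Has (avoiding κ) (S (next k) s)) →
  (∀ s → Has (avoiding κ′) (S (prev k) s)) → Has (avoiding (heavy 0F)) (Node S)
node-two-nonempty k τ κ κ′ τ≢ S h h′ h″ t _ = choose (find (blocks-forced k κ κ′))
  where
  a = inject₁ (prev k)
  T : Vec Parity 4
  T = target t ⊞ offset false
  choose : ∃[ v ] v ∈ candidates k κ × All ((a , v) ∈_) (solutions [] (blockClauses k κ κ′)) → ∃[ f ] Node S f × Avoids f t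
  -- Slot `k` reaches `prev k`; a contribution other than `v ⊕ lookup T a` there keeps `w` off the
  -- forced value `v`.
  choose (v , _ , forced) = finish (slot-avoid-at τ τ≢ k false (h false) (λ eq → prev≢ k (sym eq)) (v ⊕ lookup T a))
    where
    finish : ∃[ e ] S k false e × lookup (embed k false e) a ≢ v ⊕ lookup T a → ∃[ f ] Node S f × Avoids f t
    finish (e , Se , e≢) = two-choice S k κ κ′ (h′ false) (h″ false) e Se t {[]} [] none
      where
      w : Vec Parity 4
      w = target t ⊞ (offset false ⊞ embed k false e)
      at : lookup w a ≡ lookup T a ⊕ lookup (embed k false e) a
      at = trans (cong (λ w → lookup w a) (sym (⊞-assoc (target t) (offset false) (embed k false e))))
        (lookup-⊞ a T (embed k false e))
      none : ¬ Any (Solves w) (solutions [] (blockClauses k κ κ′))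
      none some =
        let σ , σ∈ , sol = find some
        in e≢ (⊕-moveˡ (lookup T a) (trans (sym at) (All.lookup sol (All.lookup forced σ∈))))

-- Such parts answer every target, so any kind may label them; `heavy 0F` is an arbitrary pick.
node-two : ∀ k τ κ κ′ → NodeHasAt k τ (avoiding κ) (avoiding κ′)
node-two k (exact false) κ κ′ = avoiding (heavy 0F) , node-two-empty k κ κ′
node-two k (exact true)  κ κ′ = avoiding (heavy 0F) , node-two-nonempty k (exact true) κ κ′ λ ()
node-two k (avoiding κ″) κ κ′ = avoiding (heavy 0F) , node-two-nonempty k (avoiding κ″) κ κ′ λ ()

-- Closure of the types under adding a vertex

rotate₁ : ∀ {τ₀ τ₁ τ₂} → NodeHasAt 1F τ₁ τ₂ τ₀ → NodeHasAt 0F τ₀ τ₁ τ₂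
rotate₁ (τ , has) = τ , λ S h₀ h₁ h₂ → has S h₁ h₂ h₀

rotate₂ : ∀ {τ₀ τ₁ τ₂} → NodeHasAt 2F τ₂ τ₀ τ₁ → NodeHasAt 0F τ₀ τ₁ τ₂
rotate₂ (τ , has) = τ , λ S h₀ h₁ h₂ → has S h₂ h₀ h₁

node-has : ∀ τ₀ τ₁ τ₂ → NodeHasAt 0F τ₀ τ₁ τ₂
node-has (exact false) (exact false) (exact false) = node-empty
node-has (exact true)  (exact b)     (exact b′)    = node-exact true b b′ refl
node-has (exact false) (exact true)  (exact b)     = node-exact false true b refl
node-has (exact false) (exact false) (exact true)  = node-exact false false true refl
node-has (avoiding κ)  (exact b)     (exact b′)    = node-one 0F κ b b′
node-has (exact b)     (avoiding κ)  (exact b′)    = rotate₁ (node-one 1F κ b′ b)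
node-has (exact b)     (exact b′)    (avoiding κ)  = rotate₂ (node-one 2F κ b b′)
node-has (exact b)     (avoiding κ)  (avoiding κ′) = node-two 0F (exact b) κ κ′
node-has (avoiding κ″) (avoiding κ)  (avoiding κ′) = node-two 0F (avoiding κ″) κ κ′
node-has (avoiding κ)  (exact b)     (avoiding κ′) = rotate₁ (node-two 1F (exact b) κ′ κ)
node-has (avoiding κ)  (avoiding κ′) (exact b)     = rotate₂ (node-two 2F (exact b) κ κ′)

-- Hanging parts of a graph on the natural numbers

-- F π is a set of contributions to the corners of a triangle with colours π 0, π 1, π 2, where colour π i
-- is renamed to i.
Family : Set₁
Family = Permutation′ 5 → Pred (Vec Parity 3) 0ℓ

Good : Family → Set
Good F = ∃[ τ ] ∀ π → Has τ (F π)

zeroFamily : Family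
zeroFamily _ v = v ≡ replicate 3 𝟎

_⊕ᶠ_ : Family → Family → Family
(F ⊕ᶠ G) π = F π ⊕ₛ G π

slotsAt : (F₀ F₁ F₂ : Family) → Permutation′ 5 → Slots
slotsAt F₀ F₁ F₂ π 0F s = F₀ (slotFrame 0F s ∘ₚ π)
slotsAt F₀ F₁ F₂ π 1F s = F₁ (slotFrame 1F s ∘ₚ π)
slotsAt F₀ F₁ F₂ π 2F s = F₂ (slotFrame 2F s ∘ₚ π)

nodeFamily : (F₀ F₁ F₂ : Family) → Family
nodeFamily F₀ F₁ F₂ π = Node (slotsAt F₀ F₁ F₂ π)

zeroFamily-good : Good zeroFamily
zeroFamily-good = exact false , λ _ → refl ∷ []

⊕ᶠ-good : ∀ {F G} → Good F → Good G → Good (F ⊕ᶠ G)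
⊕ᶠ-good {F} {G} (τ , h) (τ′ , h′) = sumType τ τ′ , λ π → Has-⊕ₛ τ τ′ {F π} {G π} (h π) (h′ π)

nodeFamily-good : ∀ {F₀ F₁ F₂} → Good F₀ → Good F₁ → Good F₂ → Good (nodeFamily F₀ F₁ F₂)
nodeFamily-good {F₀} {F₁} {F₂} (τ₀ , h₀) (τ₁ , h₁) (τ₂ , h₂) = good (node-has τ₀ τ₁ τ₂)
  where
  good : NodeHasAt 0F τ₀ τ₁ τ₂ → Good (nodeFamily F₀ F₁ F₂)
  good (τ , has) = τ , λ π → has (slotsAt F₀ F₁ F₂ π)
    (λ s → h₀ (slotFrame 0F s ∘ₚ π)) (λ s → h₁ (slotFrame 1F s ∘ₚ π)) (λ s → h₂ (slotFrame 2F s ∘ₚ π))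

record Hang : Set₁ where
  constructor hang
  field
    corners : Vec ℕ 3
    family  : Family
    good    : Good family

open Hang

select : ∀ {P : Set} → Dec P → Parity → Parity
select (yes _) v = v
select (no _)  _ = 𝟎

contribution : ∀ {n} → Vec ℕ n → Vec Parity n → ℕ → Parity
contribution []       []       u = 𝟎
contribution (a ∷ as) (v ∷ vs) u = select (u ≟ⁿ a) v ⊕ contribution as vs u

Colouring : Set
Colouring = ℕ → Fin 5

Matches : Colouring → Vec ℕ 3 → Permutation′ 5 → Set
Matches φ T π = ∀ i → φ (lookup T i) ≡ π ⟨$⟩ʳ own i

-- `δ u` is what all hanging parts together add to the parity vector of `u`. `Matches` fixes `π`
-- only at the corner colours, so each part may order the two free colours in its own way.
data Realises (φ : Colouring) : List Hang → (ℕ → Parity) → Set₁ where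
  []   : ∀ {δ} → (∀ u → δ u ≡ 𝟎) → Realises φ [] δ
  cons : ∀ {h hs δ δ′} π f → Matches φ (corners h) π → family h π f → Realises φ hs δ′ →
         (∀ u → δ u ≡ contribution (corners h) (Vec.map (push π) f) u ⊕ δ′ u) →
         Realises φ (h ∷ hs) δ

open CommutativeMonoidSolver ⊕-commutativeMonoid using (solve; _⊜_) renaming (_⊕_ to _:⊕_)

select-⊕ : ∀ {P : Set} (P? : Dec P) u v → select P? (u ⊕ v) ≡ select P? u ⊕ select P? v
select-⊕ (yes _) u v = refl
select-⊕ (no _)  u v = refl

contribution-⊞ : ∀ {n} (T : Vec ℕ n) f g u → contribution T (f ⊞ g) u ≡ contribution T f u ⊕ contribution T g u
contribution-⊞ []      []      []      u = refl
contribution-⊞ (a ∷ T) (v ∷ f) (w ∷ g) u = trans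
  (cong₂ _⊕_ (select-⊕ (u ≟ⁿ a) v w) (contribution-⊞ T f g u))
  (solve 4 (λ v w f g → (v :⊕ w) :⊕ (f :⊕ g) ⊜ (v :⊕ f) :⊕ (w :⊕ g)) refl
    (select (u ≟ⁿ a) v) (select (u ≟ⁿ a) w) (contribution T f u) (contribution T g u))

select-𝟎 : ∀ {P : Set} (P? : Dec P) → select P? 𝟎 ≡ 𝟎
select-𝟎 (yes _) = refl
select-𝟎 (no _)  = refl

contribution-𝟎 : ∀ {n} (T : Vec ℕ n) u → contribution T (replicate n 𝟎) u ≡ 𝟎
contribution-𝟎 []      u = refl
contribution-𝟎 (a ∷ T) u = cong₂ _⊕_ (select-𝟎 (u ≟ⁿ a)) (contribution-𝟎 T u)

contribution-removeAt : ∀ {n} (T : Vec ℕ (suc n)) k f u →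
  contribution (removeAt T k) f u ≡ contribution T (insertAt f k 𝟎) u
contribution-removeAt (a ∷ T)         0F      f       u =
  sym (trans (cong (_⊕ contribution T f u) (select-𝟎 (u ≟ⁿ a))) (⊕-identityˡ (contribution T f u)))
contribution-removeAt (a ∷ T@(_ ∷ _)) (suc k) (v ∷ f) u =
  cong (select (u ≟ⁿ a) v ⊕_) (contribution-removeAt T k f u)

contribution-outside : ∀ {n} (T : Vec ℕ n) f {u} → (∀ i → u ≢ lookup T i) → contribution T f u ≡ 𝟎
contribution-outside []      []      u∉ = refl
contribution-outside (a ∷ T) (v ∷ f) {u} u∉ with u ≟ⁿ a
... | yes u≡a = contradiction u≡a (u∉ 0F)
... | no  _   = trans (⊕-identityˡ (contribution T f u)) (contribution-outside T f (u∉ ∘ suc))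

map-push-⊞ : ∀ {n} π (f g : Vec Parity n) → Vec.map (push π) (f ⊞ g) ≡ Vec.map (push π) f ⊞ Vec.map (push π) g
map-push-⊞ π []      []      = refl
map-push-⊞ π (v ∷ f) (w ∷ g) = cong₂ _∷_ (push-⊕ π v w) (map-push-⊞ π f g)

-- Gathers the parts on `T` into one family. On the way back a single `π` serves all summands, so
-- that a sum can be split after relabelling.
extract : ∀ T (hs : List Hang) → ∃[ F ] Good F × ∃[ hs′ ] All (_∈ hs) hs′ × All (λ h → corners h ≢ T) hs′ ×
  (∀ φ π f δ → Matches φ T π → F π f → Realises φ hs′ δ →
    Realises φ hs (λ u → contribution T (Vec.map (push π) f) u ⊕ δ u))
extract T [] = zeroFamily , zeroFamily-good , [] , [] , [] ,
  λ { φ π _ δ _ refl ([] δ≡𝟎) → [] λ u → trans (cong₂ _⊕_ (vanish π u) (δ≡𝟎 u)) refl }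
  where
  vanish : ∀ π u → contribution T (Vec.map (push π) (replicate 3 𝟎)) u ≡ 𝟎
  vanish π u rewrite push-𝟎 π = contribution-𝟎 T u
extract T (h@(hang C F good) ∷ hs) with extract T hs | ≡-dec _≟ⁿ_ C T
... | G , good′ , hs′ , sub , ≢T , merge | no C≢T =
  G , good′ , h ∷ hs′ , here refl ∷ All.map there sub , C≢T ∷ ≢T ,
  λ { φ π g δ match Gg (cons {δ′ = δ′} ρ f match′ Ff rest eq) →
      cons ρ f match′ Ff (merge φ π g δ′ match Gg rest) λ u → trans
        (cong (contribution T (Vec.map (push π) g) u ⊕_) (eq u))
        (solve 3 (λ x y z → x :⊕ (y :⊕ z) ⊜ y :⊕ (x :⊕ z)) refl
          (contribution T (Vec.map (push π) g) u) (contribution C (Vec.map (push ρ) f) u) (δ′ u)) }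
... | G , good′ , hs′ , sub , ≢T , merge | yes refl =
  F ⊕ᶠ G , ⊕ᶠ-good {F} {G} good good′ , hs′ , All.map there sub , ≢T ,
  λ { φ π _ δ match (f , g , Ff , Gg , refl) rest →
      cons π f match Ff (merge φ π g δ match Gg rest) λ u → trans
        (cong (_⊕ δ u) (trans (cong (λ v → contribution T v u) (map-push-⊞ π f g))
          (contribution-⊞ T (Vec.map (push π) f) (Vec.map (push π) g) u)))
        (⊕-assoc (contribution T (Vec.map (push π) f) u) (contribution T (Vec.map (push π) g) u) (δ u)) }

Realises-cong : ∀ {φ φ′ hs δ} → All (λ h → ∀ i → φ (lookup (corners h) i) ≡ φ′ (lookup (corners h) i)) hs →
  Realises φ hs δ → Realises φ′ hs δ
Realises-cong []              ([] δ≡𝟎) = [] δ≡𝟎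
Realises-cong (agree ∷ agrees) (cons π f match Ff rest eq) =
  cons π f (λ i → trans (sym (agree i)) (match i)) Ff (Realises-cong agrees rest) eq

Realises-outside : ∀ {φ hs δ u} → All (λ h → ∀ i → u ≢ lookup (corners h) i) hs → Realises φ hs δ → δ u ≡ 𝟎
Realises-outside {u = u} []        ([] δ≡𝟎) = δ≡𝟎 u
Realises-outside {u = u} (u∉ ∷ u∉s) (cons {h} π f _ _ rest eq) = trans (eq u)
  (cong₂ _⊕_ (contribution-outside (corners h) (Vec.map (push π) f) u∉) (Realises-outside u∉s rest))

-- Sums over initial segments

sumTo : ℕ → (ℕ → Parity) → Parity
sumTo zero    g = 𝟎
sumTo (suc m) g = sumTo m g ⊕ g m

sumTo-cong : ∀ m {g g′} → (∀ {j} → j < m → g j ≡ g′ j) → sumTo m g ≡ sumTo m g′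
sumTo-cong zero    eq = refl
sumTo-cong (suc m) eq = cong₂ _⊕_ (sumTo-cong m (eq ∘ m<n⇒m<1+n)) (eq (n<1+n m))

sumTo-⊕ : ∀ m g g′ → sumTo m (λ j → g j ⊕ g′ j) ≡ sumTo m g ⊕ sumTo m g′
sumTo-⊕ zero    g g′ = refl
sumTo-⊕ (suc m) g g′ = trans (cong (_⊕ (g m ⊕ g′ m)) (sumTo-⊕ m g g′))
  (solve 4 (λ s s′ x x′ → (s :⊕ s′) :⊕ (x :⊕ x′) ⊜ (s :⊕ x) :⊕ (s′ :⊕ x′)) refl (sumTo m g) (sumTo m g′) (g m) (g′ m))

sumTo-𝟎 : ∀ m {g} → (∀ {j} → j < m → g j ≡ 𝟎) → sumTo m g ≡ 𝟎
sumTo-𝟎 zero    eq = refl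
sumTo-𝟎 (suc m) eq = cong₂ _⊕_ (sumTo-𝟎 m (eq ∘ m<n⇒m<1+n)) (eq (n<1+n m))

sumTo-point : ∀ {m a} v → a < m → sumTo m (λ j → select (j ≟ⁿ a) v) ≡ v
sumTo-point {suc m} {a} v a<1+m with m ≟ⁿ a
... | yes refl = trans (cong (_⊕ v) (sumTo-𝟎 m before)) (⊕-identityˡ v)
  where
  before : ∀ {j} → j < m → select (j ≟ⁿ m) v ≡ 𝟎
  before {j} j<m with j ≟ⁿ m
  ... | yes refl = contradiction j<m (<-irrefl refl)
  ... | no _     = refl
... | no m≢a = trans (⊕-identityʳ _) (sumTo-point v (≤∧≢⇒< (s≤s⁻¹ a<1+m) (m≢a ∘ sym)))

sumTo-contribution : ∀ {n m} (T : Vec ℕ n) f → (∀ i → lookup T i < m) → sumTo m (contribution T f) ≡ Vec.foldr _ _⊕_ 𝟎 f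
sumTo-contribution {m = m} []      []      T<m = sumTo-𝟎 m λ _ → refl
sumTo-contribution {m = m} (a ∷ T) (v ∷ f) T<m = trans
  (sumTo-⊕ m (λ j → select (j ≟ⁿ a) v) (contribution T f))
  (cong₂ _⊕_ (sumTo-point v (T<m 0F)) (sumTo-contribution T f (T<m ∘ suc)))

-- The parity vectors of the corners of a bare triangle.
triangleTarget : Vec Parity 3
triangleTarget = set (1F ∷ 2F ∷ []) ∷ set (0F ∷ 2F ∷ []) ∷ set (0F ∷ 1F ∷ []) ∷ []

opaque
  triangleTarget∉ : ∀ κ → ¬ triangleTarget ∈ exceptions κ
  triangleTarget∉ = from-yes (∀Kind? λ κ → ¬? (triangleTarget ∈³? exceptions κ))

avoid-triangleTarget : ∀ τ {S} → Has τ S → ∃[ f ] S f × Avoids f triangleTarget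
avoid-triangleTarget (exact false) (z ∷ []) = _ , z , λ { 0F () ; 1F () ; 2F () }
avoid-triangleTarget (exact true) (u ∷ _)   = _ , u , λ { 0F () ; 1F () ; 2F () }
avoid-triangleTarget (avoiding κ) h         = h triangleTarget (triangleTarget∉ κ)

vertexColour : Bool → Fin 4 → Fin 5
vertexColour s 0F = 0F
vertexColour s 1F = 1F
vertexColour s 2F = 2F
vertexColour s 3F = newColour s

opaque
  slotFrame-own : ∀ s k i → slotFrame k s ⟨$⟩ʳ own i ≡ vertexColour s (punchIn (inject₁ k) i)
  slotFrame-own = from-yes (∀Bool? λ s → all? λ k → all? λ i →
    (slotFrame k s ⟨$⟩ʳ own i) ≟ vertexColour s (punchIn (inject₁ k) i))

  newColour≢own : ∀ s i → newColour s ≢ own i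
  newColour≢own = from-yes (∀Bool? λ s → all? λ i → ¬? (newColour s ≟ own i))

push-id : ∀ v → push idₚ v ≡ v
push-id = tabulate∘lookup

-- Colouring by removing vertices from the last one down

module Colour (_~_ : ℕ → ℕ → Set) (_~?_ : ∀ u v → Dec (u ~ v))
              (~-sym : ∀ {u v} → u ~ v → v ~ u) (~-irrefl : ∀ {u} → ¬ u ~ u) where

  -- Sorting gives each triangle a single vector of corners, so `extract` recognises parts on the
  -- same triangle by equality.
  Triangle : ℕ → Vec ℕ 3 → Set
  Triangle m (a ∷ b ∷ c ∷ []) = (a < b × b < c × c < m) × (a ~ b × b ~ c × a ~ c)

  Parents : ℕ → Vec ℕ 3 → Set
  Parents m T = Triangle m T × (∀ i → m ~ lookup T i) × (∀ {j} → j < m → m ~ j → ∃[ i ] j ≡ lookup T i)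

  Hung : ℕ → List Hang → Set₁
  Hung m = All (λ h → Triangle m (corners h))

  neighbours : Colouring → ℕ → ℕ → Parity
  neighbours φ m u = sumTo m (λ j → select (u ~? j) (unit (φ j)))

  -- Vertices inside hanging parts do not appear: each was satisfied when its part was formed, by
  -- the last condition of `Node`.
  record Solution (m : ℕ) (hs : List Hang) : Set₁ where
    field
      φ         : Colouring
      proper    : ∀ {u v} → u < m → v < m → u ~ v → φ u ≢ φ v
      δ         : ℕ → Parity
      realises  : Realises φ hs δ
      satisfied : ∀ {u} → u < m → neighbours φ m u ⊕ δ u ≢ 𝟎

  corners-<  : ∀ {m} T → Triangle m T → ∀ i → lookup T i < m
  corners-< (a ∷ b ∷ c ∷ []) ((a<b , b<c , c<m) , _) 0F = <-trans a<b (<-trans b<c c<m)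
  corners-< (a ∷ b ∷ c ∷ []) ((a<b , b<c , c<m) , _) 1F = <-trans b<c c<m
  corners-< (a ∷ b ∷ c ∷ []) ((a<b , b<c , c<m) , _) 2F = c<m

  contribution-corners : ∀ {m} T → Triangle m T → ∀ {P : ℕ → Set} (P? : ∀ j → Dec (P j)) →
    (∀ i → P (lookup T i)) → ∀ (w : ℕ → Parity) j → (P j → ∃[ i ] j ≡ lookup T i) →
    select (P? j) (w j) ≡ contribution T (Vec.map w T) j
  contribution-corners T@(a ∷ b ∷ c ∷ []) ((a<b , b<c , _) , _) P? PT w j P⇒T with P? j | j ≟ⁿ a | j ≟ⁿ b | j ≟ⁿ c
  ... | _      | yes refl | yes refl | _        = contradiction a<b (<-irrefl refl)
  ... | _      | yes refl | no _     | yes refl = contradiction (<-trans a<b b<c) (<-irrefl refl)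
  ... | _      | no _     | yes refl | yes refl = contradiction b<c (<-irrefl refl)
  ... | yes _  | yes refl | no _     | no _     = sym (⊕-identityʳ (w j))
  ... | yes _  | no _     | yes refl | no _     = sym (trans (⊕-identityˡ _) (⊕-identityʳ (w j)))
  ... | yes _  | no _     | no _     | yes refl = sym (trans (⊕-identityˡ _) (trans (⊕-identityˡ _) (⊕-identityʳ (w j))))
  ... | no ¬Pj | yes refl | _        | _        = contradiction (PT 0F) ¬Pj
  ... | no ¬Pj | _        | yes refl | _        = contradiction (PT 1F) ¬Pj
  ... | no ¬Pj | _        | _        | yes refl = contradiction (PT 2F) ¬Pj
  ... | no _   | no _     | no _     | no _     = refl
  ... | yes Pj | no j≢a   | no j≢b   | no j≢c   with P⇒T Pj
  ...   | 0F , eq = contradiction eq j≢a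
  ...   | 1F , eq = contradiction eq j≢b
  ...   | 2F , eq = contradiction eq j≢c

  -- Below 3 there is only one sorted triangle, so extracting it leaves no part, and one reply to
  -- `triangleTarget` satisfies all three vertices.
  base : 0 ~ 1 → 1 ~ 2 → 0 ~ 2 → ∀ hs → Hung 3 hs → Solution 3 hs
  base 0~1 1~2 0~2 hs hung = solution (extract (0 ∷ 1 ∷ 2 ∷ []) hs)
    where
    T : Vec ℕ 3
    T = 0 ∷ 1 ∷ 2 ∷ []
    only : ∀ C → Triangle 3 C → C ≡ T
    only (0 ∷ 1 ∷ 2 ∷ []) _ = refl
    only (_ ∷ _ ∷ suc (suc (suc _)) ∷ []) ((_ , _ , s≤s (s≤s (s≤s ()))) , _)
    only (_ ∷ suc (suc _) ∷ 2 ∷ []) ((_ , s≤s (s≤s ()) , _) , _)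
    only (_ ∷ suc _ ∷ 1 ∷ []) ((_ , s≤s () , _) , _)
    only (suc _ ∷ 1 ∷ 2 ∷ []) ((s≤s () , _ , _) , _)
    φ₀ : Colouring
    φ₀ 0             = 0F
    φ₀ 1             = 1F
    φ₀ (suc (suc _)) = 2F
    solution : ∃[ F ] Good F × ∃[ hs′ ] All (_∈ hs) hs′ × All (λ h → corners h ≢ T) hs′ ×
      (∀ φ π f δ → Matches φ T π → F π f → Realises φ hs′ δ →
        Realises φ hs (λ u → contribution T (Vec.map (push π) f) u ⊕ δ u)) → Solution 3 hs
    solution (F , _ , h ∷ _ , h∈ ∷ _ , ≢T ∷ _ , _) = contradiction (only (corners h) (All.lookup hung h∈)) ≢T
    solution (F , (τ , good) , [] , _ , _ , merge) with avoid-triangleTarget τ (good idₚ)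
    ... | f@(x ∷ y ∷ z ∷ []) , Ff , avoid = record
      { φ         = φ₀
      ; proper    = proper
      ; δ         = δ
      ; realises  = merge φ₀ idₚ f (λ _ → 𝟎) (λ { 0F → refl ; 1F → refl ; 2F → refl }) Ff ([] λ _ → refl)
      ; satisfied = satisfied
      }
      where
      δ : ℕ → Parity
      δ u = contribution T (Vec.map (push idₚ) f) u ⊕ 𝟎
      proper : ∀ {u v} → u < 3 → v < 3 → u ~ v → φ₀ u ≢ φ₀ v
      proper {0} {0} _ _ u~v _ = ~-irrefl u~v
      proper {1} {1} _ _ u~v _ = ~-irrefl u~v
      proper {2} {2} _ _ u~v _ = ~-irrefl u~v
      proper {suc (suc (suc _))} (s≤s (s≤s (s≤s ())))
      proper {_} {suc (suc (suc _))} _ (s≤s (s≤s (s≤s ())))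
      cancel : ∀ {u v} t → u ⊕ v ≡ 𝟎 → u ≡ t → v ≡ t
      cancel {u} {v} t eq refl = trans (⊕-moveˡ u eq) (⊕-identityˡ u)
      satisfied : ∀ {u} → u < 3 → neighbours φ₀ 3 u ⊕ δ u ≢ 𝟎
      satisfied {0} _ with 0 ~? 0 | 0 ~? 1 | 0 ~? 2
      ... | yes 0~0 | _        | _        = contradiction 0~0 ~-irrefl
      ... | _       | no ¬0~1  | _        = contradiction 0~1 ¬0~1
      ... | _       | _        | no ¬0~2  = contradiction 0~2 ¬0~2
      ... | no _    | yes _    | yes _    = λ eq → avoid 0F (trans (sym value) (cancel (set (1F ∷ 2F ∷ [])) eq refl))
        where
        value : δ 0 ≡ x
        value = trans (⊕-identityʳ _) (trans (⊕-identityʳ _) (push-id x))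
      satisfied {1} _ with 1 ~? 0 | 1 ~? 1 | 1 ~? 2
      ... | _       | yes 1~1  | _        = contradiction 1~1 ~-irrefl
      ... | no ¬1~0 | _        | _        = contradiction (~-sym 0~1) ¬1~0
      ... | _       | _        | no ¬1~2  = contradiction 1~2 ¬1~2
      ... | yes _   | no _     | yes _    = λ eq → avoid 1F (trans (sym value) (cancel (set (0F ∷ 2F ∷ [])) eq refl))
        where
        value : δ 1 ≡ y
        value = trans (⊕-identityʳ _) (trans (⊕-identityˡ _) (trans (⊕-identityʳ _) (push-id y)))
      satisfied {2} _ with 2 ~? 0 | 2 ~? 1 | 2 ~? 2
      ... | _       | _        | yes 2~2  = contradiction 2~2 ~-irrefl
      ... | no ¬2~0 | _        | _        = contradiction (~-sym 0~2) ¬2~0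
      ... | _       | no ¬2~1  | _        = contradiction (~-sym 1~2) ¬2~1
      ... | yes _   | yes _    | no _     = λ eq → avoid 2F (trans (sym value) (cancel (set (0F ∷ 1F ∷ [])) eq refl))
        where
        value : δ 2 ≡ z
        value = trans (⊕-identityʳ _) (trans (⊕-identityˡ _) (trans (⊕-identityˡ _) (trans (⊕-identityʳ _) (push-id z))))
      satisfied {suc (suc (suc _))} (s≤s (s≤s (s≤s ())))

  -- Replacing the last vertex by a hanging part

  module Step {m a b c} (parents-m : Parents m (a ∷ b ∷ c ∷ [])) where

    T : Vec ℕ 3
    T = a ∷ b ∷ c ∷ []

    K : Vec ℕ 4
    K = a ∷ b ∷ c ∷ m ∷ []

    slotCorners : Fin 3 → Vec ℕ 3
    slotCorners k = removeAt K (inject₁ k)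

    triangle : Triangle m T
    triangle = proj₁ parents-m

    m~T : ∀ i → m ~ lookup T i
    m~T = proj₁ (proj₂ parents-m)

    m~⇒T : ∀ {j} → j < m → m ~ j → ∃[ i ] j ≡ lookup T i
    m~⇒T = proj₂ (proj₂ parents-m)

    T<m : ∀ i → lookup T i < m
    T<m = corners-< T triangle

    -- In a sorted triangle through `m` the vertex `m` comes last and the other two are parents of
    -- it, which makes the triangle a slot.
    older : ∀ C → Triangle (suc m) C → (∀ k → C ≢ slotCorners k) → Triangle m C
    older (x ∷ y ∷ z ∷ []) ((x<y , y<z , z<1+m) , x~y , y~z , x~z) C≢ with m≤n⇒m<n∨m≡n (s≤s⁻¹ z<1+m)
    ... | inj₁ z<m  = (x<y , y<z , z<m) , x~y , y~z , x~z
    ... | inj₂ refl = ⊥-elim (slot x<y (m~⇒T (<-trans x<y y<z) (~-sym x~z)) (m~⇒T y<z (~-sym y~z)))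
      where
      a<b = proj₁ (proj₁ triangle)
      b<c = proj₁ (proj₂ (proj₁ triangle))
      slot : x < y → ∃[ i ] x ≡ lookup T i → ∃[ j ] y ≡ lookup T j → ⊥
      slot _   (0F , refl) (1F , refl) = C≢ 2F refl
      slot _   (0F , refl) (2F , refl) = C≢ 1F refl
      slot _   (1F , refl) (2F , refl) = C≢ 0F refl
      slot x<y (0F , refl) (0F , refl) = <-irrefl refl x<y
      slot x<y (1F , refl) (1F , refl) = <-irrefl refl x<y
      slot x<y (2F , refl) (2F , refl) = <-irrefl refl x<y
      slot x<y (1F , refl) (0F , refl) = <-irrefl refl (<-trans x<y a<b)
      slot x<y (2F , refl) (1F , refl) = <-irrefl refl (<-trans x<y b<c)
      slot x<y (2F , refl) (0F , refl) = <-irrefl refl (<-trans x<y (<-trans a<b b<c))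

    lookup-removeAt : ∀ k i → lookup (removeAt K k) i ≡ lookup K (punchIn k i)
    lookup-removeAt k i = trans (cong (lookup (removeAt K k)) (sym (punchOut-punchIn k)))
      (removeAt-punchOut K (punchInᵢ≢i k i ∘ sym))

    contribution-slot : ∀ π k s f u →
      contribution (slotCorners k) (Vec.map (push (slotFrame k s ∘ₚ π)) f) u ≡ contribution K (Vec.map (push π) (embed k s f)) u
    contribution-slot π k s f u = trans (contribution-removeAt K (inject₁ k) (Vec.map (push (slotFrame k s ∘ₚ π)) f) u)
      (cong (λ w → contribution K w u) (sym (begin
        Vec.map (push π) (insertAt (Vec.map (push ρ) f) k′ 𝟎)             ≡⟨ map-insertAt (push π) 𝟎 (Vec.map (push ρ) f) k′ ⟩
        insertAt (Vec.map (push π) (Vec.map (push ρ) f)) k′ (push π 𝟎)    ≡⟨ cong₂ (λ g v → insertAt g k′ v) pushes (push-𝟎 π) ⟩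
        insertAt (Vec.map (push (ρ ∘ₚ π)) f) k′ 𝟎                         ∎)))
      where
      open ≡-Reasoning
      ρ = slotFrame k s
      k′ = inject₁ k
      pushes : Vec.map (push π) (Vec.map (push ρ) f) ≡ Vec.map (push (ρ ∘ₚ π)) f
      pushes = trans (sym (map-∘ (push π) (push ρ) f)) (map-cong (λ v → sym (push-∘ ρ π v)) f)

    at-new : ∀ w → contribution K w m ≡ lookup w 3F
    at-new (x ∷ y ∷ z ∷ v ∷ []) with m ≟ⁿ a | m ≟ⁿ b | m ≟ⁿ c | m ≟ⁿ m
    ... | yes refl | _        | _        | _      = contradiction (T<m 0F) (<-irrefl refl)
    ... | _        | yes refl | _        | _      = contradiction (T<m 1F) (<-irrefl refl)
    ... | _        | _        | yes refl | _      = contradiction (T<m 2F) (<-irrefl refl)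
    ... | _        | _        | _        | no m≢m = contradiction refl m≢m
    ... | no _     | no _     | no _     | yes _  =
      trans (⊕-identityˡ _) (trans (⊕-identityˡ _) (trans (⊕-identityˡ _) (⊕-identityʳ v)))

    at-old : ∀ {u} → u < m → ∀ w f → (∀ i → lookup w (inject₁ i) ≡ lookup f i) → contribution K w u ≡ contribution T f u
    at-old {u} u<m (x ∷ y ∷ z ∷ v ∷ []) (x′ ∷ y′ ∷ z′ ∷ []) eq with u ≟ⁿ m
    ... | yes refl = contradiction u<m (<-irrefl refl)
    ... | no _     = cong₂ _⊕_ (cong (select (u ≟ⁿ a)) (eq 0F)) (cong₂ _⊕_ (cong (select (u ≟ⁿ b)) (eq 1F))
                       (cong₂ _⊕_ (cong (select (u ≟ⁿ c)) (eq 2F)) refl))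

    module Extend (φ : Colouring) (proper : ∀ {u v} → u < m → v < m → u ~ v → φ u ≢ φ v)
                  (π : Permutation′ 5) (match : Matches φ T π) (s : Bool) where

      recolour : ∀ u → Dec (u ≡ m) → Fin 5
      recolour u (yes _) = π ⟨$⟩ʳ newColour s
      recolour u (no _)  = φ u

      φ′ : Colouring
      φ′ u = recolour u (u ≟ⁿ m)

      φ′-old : ∀ {u} → u < m → φ u ≡ φ′ u
      φ′-old {u} u<m with u ≟ⁿ m
      ... | yes refl = contradiction u<m (<-irrefl refl)
      ... | no _     = refl

      φ′-new : φ′ m ≡ π ⟨$⟩ʳ newColour s
      φ′-new with m ≟ⁿ m
      ... | yes _  = refl
      ... | no m≢m = contradiction refl m≢m

      φ′-new≢ : ∀ {v} → v < m → m ~ v → φ′ m ≢ φ′ v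
      φ′-new≢ v<m m~v eq with m~⇒T v<m m~v
      ... | i , refl = newColour≢own s i (begin
        newColour s                       ≡⟨ inverseˡ π ⟨
        π ⟨$⟩ˡ (π ⟨$⟩ʳ newColour s)      ≡⟨ cong (π ⟨$⟩ˡ_) (trans (sym φ′-new) (trans eq (trans (sym (φ′-old v<m)) (match i)))) ⟩
        π ⟨$⟩ˡ (π ⟨$⟩ʳ own i)            ≡⟨ inverseˡ π ⟩
        own i                             ∎)
        where open ≡-Reasoning

      proper′ : ∀ {u v} → u < suc m → v < suc m → u ~ v → φ′ u ≢ φ′ v
      proper′ u<1+m v<1+m u~v with m≤n⇒m<n∨m≡n (s≤s⁻¹ u<1+m) | m≤n⇒m<n∨m≡n (s≤s⁻¹ v<1+m)
      ... | inj₁ u<m  | inj₁ v<m  = λ eq → proper u<m v<m u~v (trans (φ′-old u<m) (trans eq (sym (φ′-old v<m))))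
      ... | inj₁ u<m  | inj₂ refl = λ eq → φ′-new≢ u<m (~-sym u~v) (sym eq)
      ... | inj₂ refl | inj₁ v<m  = φ′-new≢ v<m u~v
      ... | inj₂ refl | inj₂ refl = λ _ → ~-irrefl u~v

      φ′-K : ∀ j → φ′ (lookup K j) ≡ π ⟨$⟩ʳ vertexColour s j
      φ′-K 0F = trans (sym (φ′-old (T<m 0F))) (match 0F)
      φ′-K 1F = trans (sym (φ′-old (T<m 1F))) (match 1F)
      φ′-K 2F = trans (sym (φ′-old (T<m 2F))) (match 2F)
      φ′-K 3F = φ′-new

      matches : ∀ k → Matches φ′ (slotCorners k) (slotFrame k s ∘ₚ π)
      matches k i = trans (cong φ′ (lookup-removeAt (inject₁ k) i))
        (trans (φ′-K (punchIn (inject₁ k) i)) (cong (π ⟨$⟩ʳ_) (sym (slotFrame-own s k i))))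

      neighbours-old : ∀ u → neighbours φ′ m u ≡ neighbours φ m u
      neighbours-old u = sumTo-cong m λ {j} j<m → cong (λ x → select (u ~? j) (unit x)) (sym (φ′-old j<m))

      -- The additional summand is the new vertex: its parents alone see it among the old vertices,
      -- and it does not see itself.
      neighbours-new : ∀ {u} → u < suc m →
        neighbours φ′ (suc m) u ≡ neighbours φ m u ⊕ contribution K (Vec.map (push π) (offset s)) u
      neighbours-new {u} u<1+m = cong₂ _⊕_ (neighbours-old u) (last (m≤n⇒m<n∨m≡n (s≤s⁻¹ u<1+m)))
        where
        γ : Parity
        γ = push π (unit (newColour s))
        colour : unit (φ′ m) ≡ γ
        colour = trans (cong unit φ′-new) (sym (push-unit π (newColour s)))
        last : u < m ⊎ u ≡ m → select (u ~? m) (unit (φ′ m)) ≡ contribution K (Vec.map (push π) (offset s)) u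
        last (inj₁ u<m) = begin
          select (u ~? m) (unit (φ′ m))          ≡⟨ cong (select (u ~? m)) colour ⟩
          select (u ~? m) γ                      ≡⟨ contribution-corners T triangle (_~? m) (λ i → ~-sym (m~T i)) (λ _ → γ) u (λ u~m → m~⇒T u<m (~-sym u~m)) ⟩
          contribution T (γ ∷ γ ∷ γ ∷ []) u      ≡⟨ at-old u<m (Vec.map (push π) (offset s)) (γ ∷ γ ∷ γ ∷ []) (λ { 0F → refl ; 1F → refl ; 2F → refl }) ⟨
          contribution K (Vec.map (push π) (offset s)) u ∎
          where open ≡-Reasoning
        last (inj₂ refl) with m ~? m
        ... | yes m~m = contradiction m~m ~-irrefl
        ... | no _    = sym (trans (at-new (Vec.map (push π) (offset s))) (push-𝟎 π))

      neighbours-m : neighbours φ m m ≡ push π parents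
      neighbours-m = begin
        neighbours φ m m
          ≡⟨ sumTo-cong m (λ {j} j<m → contribution-corners T triangle (m ~?_) m~T (unit ∘ φ) j (m~⇒T j<m)) ⟩
        sumTo m (contribution T (Vec.map (unit ∘ φ) T))
          ≡⟨ sumTo-contribution T (Vec.map (unit ∘ φ) T) T<m ⟩
        unit (φ a) ⊕ (unit (φ b) ⊕ (unit (φ c) ⊕ 𝟎))
          ≡⟨ cong₂ _⊕_ (colour 0F) (cong₂ _⊕_ (colour 1F) (cong₂ _⊕_ (colour 2F) (sym (push-𝟎 π)))) ⟩
        push π (unit 0F) ⊕ (push π (unit 1F) ⊕ (push π (unit 2F) ⊕ push π 𝟎))
          ≡⟨ cong (λ v → push π (unit 0F) ⊕ (push π (unit 1F) ⊕ v)) (push-⊕ π (unit 2F) 𝟎) ⟨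
        push π (unit 0F) ⊕ (push π (unit 1F) ⊕ push π (unit 2F ⊕ 𝟎))
          ≡⟨ cong (push π (unit 0F) ⊕_) (push-⊕ π (unit 1F) (unit 2F ⊕ 𝟎)) ⟨
        push π (unit 0F) ⊕ push π (unit 1F ⊕ (unit 2F ⊕ 𝟎))
          ≡⟨ push-⊕ π (unit 0F) (unit 1F ⊕ (unit 2F ⊕ 𝟎)) ⟨
        push π parents ∎
        where
        open ≡-Reasoning
        colour : ∀ i → unit (φ (lookup T i)) ≡ push π (unit (own i))
        colour i = trans (cong unit (match i)) (sym (push-unit π (own i)))

      module _ (f₀ f₁ f₂ : Vec Parity 3) (δ′ : ℕ → Parity) where

        slotContribution : Fin 3 → Vec Parity 3 → ℕ → Parity
        slotContribution k f u = contribution (slotCorners k) (Vec.map (push (slotFrame k s ∘ₚ π)) f) u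

        δ-new : ℕ → Parity
        δ-new u = slotContribution 0F f₀ u ⊕ (slotContribution 1F f₁ u ⊕ (slotContribution 2F f₂ u ⊕ δ′ u))

        w : Vec Parity 4
        w = total s f₀ f₁ f₂

        -- Contributions are additive and every slot embeds into the K₄, so the edges at `m` and the
        -- three slots act through the one vector `w`.
        new-total : ∀ {u} → u < suc m →
          neighbours φ′ (suc m) u ⊕ δ-new u ≡ neighbours φ m u ⊕ (contribution K (Vec.map (push π) w) u ⊕ δ′ u)
        new-total {u} u<1+m = begin
          neighbours φ′ (suc m) u ⊕ δ-new u
            ≡⟨ cong₂ _⊕_ (neighbours-new u<1+m) (cong₂ _⊕_ (contribution-slot π 0F s f₀ u)
                 (cong₂ _⊕_ (contribution-slot π 1F s f₁ u) (cong (_⊕ δ′ u) (contribution-slot π 2F s f₂ u)))) ⟩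
          (neighbours φ m u ⊕ C (offset s)) ⊕ (C e₀ ⊕ (C e₁ ⊕ (C e₂ ⊕ δ′ u)))
            ≡⟨ solve 6 (λ n o x y z d → (n :⊕ o) :⊕ (x :⊕ (y :⊕ (z :⊕ d))) ⊜ n :⊕ ((o :⊕ (x :⊕ (y :⊕ z))) :⊕ d)) refl
                 (neighbours φ m u) (C (offset s)) (C e₀) (C e₁) (C e₂) (δ′ u) ⟩
          neighbours φ m u ⊕ ((C (offset s) ⊕ (C e₀ ⊕ (C e₁ ⊕ C e₂))) ⊕ δ′ u)
            ≡⟨ cong (λ x → neighbours φ m u ⊕ (x ⊕ δ′ u)) sums ⟩
          neighbours φ m u ⊕ (C w ⊕ δ′ u) ∎
          where
          open ≡-Reasoning
          C : Vec Parity 4 → Parity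
          C v = contribution K (Vec.map (push π) v) u
          e₀ = embed 0F s f₀
          e₁ = embed 1F s f₁
          e₂ = embed 2F s f₂
          C-⊞ : ∀ v v′ → C (v ⊞ v′) ≡ C v ⊕ C v′
          C-⊞ v v′ = trans (cong (λ x → contribution K x u) (map-push-⊞ π v v′))
            (contribution-⊞ K (Vec.map (push π) v) (Vec.map (push π) v′) u)
          sums : C (offset s) ⊕ (C e₀ ⊕ (C e₁ ⊕ C e₂)) ≡ C w
          sums = sym (trans (C-⊞ (offset s) (e₀ ⊞ (e₁ ⊞ e₂))) (cong (C (offset s) ⊕_)
            (trans (C-⊞ e₀ (e₁ ⊞ e₂)) (cong (C e₀ ⊕_) (C-⊞ e₁ e₂)))))

    -- The vertex `m` and the parts on its slots become the single part `node` on the parents. A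
    -- solution with `node` already contains the colour of `m` and the replies in the slots, and
    -- these are unpacked.
    step : (∀ hs → Hung m hs → Solution m hs) → ∀ hs → Hung (suc m) hs → Solution (suc m) hs
    step solve-m hs hung with extract (slotCorners 0F) hs
    ... | F₀ , good₀ , hs₁ , hs₁⊆ , ≢₀ , merge₀ with extract (slotCorners 1F) hs₁
    ... | F₁ , good₁ , hs₂ , hs₂⊆ , ≢₁ , merge₁ with extract (slotCorners 2F) hs₂
    ... | F₂ , good₂ , hs₃ , hs₃⊆ , ≢₂ , merge₂ = result (solve-m (node ∷ hs₃) (triangle ∷ hung₃))
      where
      node : Hang
      node = hang T (nodeFamily F₀ F₁ F₂) (nodeFamily-good {F₀} {F₁} {F₂} good₀ good₁ good₂)
      hung₃ : Hung m hs₃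
      hung₃ = All.tabulate λ {h} h∈ →
        let h∈₂ = All.lookup hs₃⊆ h∈
            h∈₁ = All.lookup hs₂⊆ h∈₂
        in older (corners h) (All.lookup hung (All.lookup hs₁⊆ h∈₁)) λ
             { 0F → All.lookup ≢₀ h∈₁ ; 1F → All.lookup ≢₁ h∈₂ ; 2F → All.lookup ≢₂ h∈ }
      result : Solution m (node ∷ hs₃) → Solution (suc m) hs
      result record { φ = φ ; proper = proper ; δ = δ ; satisfied = satisfied
                    ; realises = cons {δ′ = δ′} π v match (s , f₀ , f₁ , f₂ , (Ff₀ , Ff₁ , Ff₂) , same , new≢) rest eq } = record
        { φ         = φ′
        ; proper    = proper′
        ; δ         = δ-new f₀ f₁ f₂ δ′
        ; realises  = merge₀ φ′ (slotFrame 0F s ∘ₚ π) f₀ _ (matches 0F) Ff₀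
                        (merge₁ φ′ (slotFrame 1F s ∘ₚ π) f₁ _ (matches 1F) Ff₁
                          (merge₂ φ′ (slotFrame 2F s ∘ₚ π) f₂ _ (matches 2F) Ff₂
                            (Realises-cong (All.map (λ {h} t i → φ′-old (corners-< (corners h) t i)) hung₃) rest)))
        ; satisfied = λ {u} u<1+m → satisfied′ u<1+m (m≤n⇒m<n∨m≡n (s≤s⁻¹ u<1+m))
        }
        where
        open Extend φ proper π match s
        W : Vec Parity 4
        W = total s f₀ f₁ f₂
        satisfied′ : ∀ {u} → u < suc m → u < m ⊎ u ≡ m → neighbours φ′ (suc m) u ⊕ δ-new f₀ f₁ f₂ δ′ u ≢ 𝟎
        -- For an old vertex the sum is unchanged: the first three entries of the total are the
        -- contribution `v` of `node`.
        satisfied′ {u} u<1+m (inj₁ u<m) eq0 = satisfied u<m (trans (cong (neighbours φ m u ⊕_) same-δ)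
          (trans (sym (new-total f₀ f₁ f₂ δ′ u<1+m)) eq0))
          where
          same-δ : δ u ≡ contribution K (Vec.map (push π) W) u ⊕ δ′ u
          same-δ = trans (eq u) (cong (_⊕ δ′ u) (sym (at-old u<m (Vec.map (push π) W) (Vec.map (push π) v) λ i →
            trans (lookup-map (inject₁ i) (push π) W) (trans (cong (push π) (same i)) (sym (lookup-map i (push π) v))))))
        -- The remaining parts add nothing at `m`, so a zero parity vector would make its entry of
        -- the total equal to `parents`.
        satisfied′ u<1+m (inj₂ refl) eq0 = new≢ (begin
          lookup W 3F                                       ≡⟨ push-flip (flip π) (lookup W 3F) ⟨
          push (flip π) (push π (lookup W 3F))              ≡⟨ cong (push (flip π)) same-parents ⟩
          push (flip π) (push π parents)                    ≡⟨ push-flip (flip π) parents ⟩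
          parents                                           ∎)
          where
          open ≡-Reasoning
          δ′-m : δ′ m ≡ 𝟎
          δ′-m = Realises-outside (All.map (λ {h} t i m≡ → <-irrefl (sym m≡) (corners-< (corners h) t i)) hung₃) rest
          same-parents : push π (lookup W 3F) ≡ push π parents
          same-parents = begin
            push π (lookup W 3F)                                   ≡⟨ lookup-map 3F (push π) W ⟨
            lookup (Vec.map (push π) W) 3F                         ≡⟨ at-new (Vec.map (push π) W) ⟨
            contribution K (Vec.map (push π) W) m                  ≡⟨ ⊕-identityʳ _ ⟨
            contribution K (Vec.map (push π) W) m ⊕ 𝟎              ≡⟨ cong (contribution K (Vec.map (push π) W) m ⊕_) δ′-m ⟨
            contribution K (Vec.map (push π) W) m ⊕ δ′ m           ≡⟨ ⊕-moveˡ (neighbours φ m m) (trans (sym (new-total f₀ f₁ f₂ δ′ u<1+m)) eq0) ⟩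
            𝟎 ⊕ neighbours φ m m                                   ≡⟨ ⊕-identityˡ _ ⟩
            neighbours φ m m                                       ≡⟨ neighbours-m ⟩
            push π parents                                         ∎

  -- An arbitrary list `hs` is what makes the induction go through; the theorem starts from the
  -- empty one.
  colour : 0 ~ 1 → 1 ~ 2 → 0 ~ 2 → ∀ k → (∀ {m} → 3 ≤ m → m < 3 + k → ∃[ T ] Parents m T) →
    ∀ hs → Hung (3 + k) hs → Solution (3 + k) hs
  colour 0~1 1~2 0~2 zero    _       = base 0~1 1~2 0~2
  colour 0~1 1~2 0~2 (suc k) parents-of = extend-by (parents-of (s≤s (s≤s (s≤s z≤n))) (n<1+n (3 + k)))
    where
    extend-by : ∃[ T ] Parents (3 + k) T → ∀ hs → Hung (suc (3 + k)) hs → Solution (suc (3 + k)) hs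
    extend-by (_ ∷ _ ∷ _ ∷ [] , parents-m) =
      Step.step parents-m (colour 0~1 1~2 0~2 k λ 3≤m m<3+k → parents-of 3≤m (m<n⇒m<1+n m<3+k))

-- Back to finite graphs

open CommutativeMonoidSum ⊕-commutativeMonoid using (sum-permute; sum-cong-≗) renaming (sum to ⨁)

injective⇒surjective : ∀ {n} (f : Fin n → Fin n) → Injective _≡_ _≡_ f → ∀ v → ∃[ i ] f i ≡ v
injective⇒surjective {suc n} f inj v with any? (λ i → f i ≟ v)
... | yes found = found
... | no  none  = contradiction (injective⇒≤ {f = avoid} (inj ∘ punchOut-injective (missed _) (missed _))) 1+n≰n
  where
  missed : ∀ i → v ≢ f i
  missed i eq = none (i , sym eq)
  avoid : Fin (suc n) → Fin n
  avoid i = punchOut (missed i)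

fromInjective : ∀ {n} (f : Fin n → Fin n) → Injective _≡_ _≡_ f → Permutation′ n
fromInjective f inj = permutation f (λ v → proj₁ (preimage v)) (λ v → proj₂ (preimage v)) (λ i → inj (proj₂ (preimage (f i))))
  where preimage = injective⇒surjective f inj

sumTo-head : ∀ m g → sumTo (suc m) g ≡ g 0 ⊕ sumTo m (g ∘ suc)
sumTo-head zero    g = ⊕-comm 𝟎 (g 0)
sumTo-head (suc m) g = trans (cong (_⊕ g (suc m)) (sumTo-head m g)) (⊕-assoc (g 0) (sumTo m (g ∘ suc)) (g (suc m)))

sumTo-⨁ : ∀ m g → sumTo m g ≡ ⨁ {m} (g ∘ toℕ)
sumTo-⨁ zero    g = refl
sumTo-⨁ (suc m) g = trans (sumTo-head m g) (cong (g 0 ⊕_) (sumTo-⨁ m (g ∘ suc)))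

odd : ℕ → Bool
odd zero    = false
odd (suc m) = not (odd m)

odd-+ : ∀ m n → odd (m + n) ≡ odd m xor odd n
odd-+ zero    n = refl
odd-+ (suc m) n = trans (cong not (odd-+ m n)) (not-distribˡ-xor (odd m) (odd n))

odd⇒Odd : ∀ m → odd m ≡ true → Odd m
odd⇒Odd 1             _  = refl
odd⇒Odd (suc (suc m)) eq = odd⇒Odd m (trans (sym (not-involutive (odd m))) eq)

lookup-⨁ : ∀ {n} c (g : Fin n → Parity) (f : Fin n → ℕ) → (∀ u → lookup (g u) c ≡ odd (f u)) →
  lookup (⨁ g) c ≡ odd (sum (List.tabulate f))
lookup-⨁ {zero}  c g f eq = lookup-replicate c false
lookup-⨁ {suc n} c g f eq = begin
  lookup (g 0F ⊕ ⨁ (g ∘ suc)) c                    ≡⟨ lookup-zipWith _xor_ c (g 0F) (⨁ (g ∘ suc)) ⟩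
  lookup (g 0F) c xor lookup (⨁ (g ∘ suc)) c        ≡⟨ cong₂ _xor_ (eq 0F) (lookup-⨁ c (g ∘ suc) (f ∘ suc) (eq ∘ suc)) ⟩
  odd (f 0F) xor odd (sum (List.tabulate (f ∘ suc))) ≡⟨ odd-+ (f 0F) _ ⟨
  odd (f 0F + sum (List.tabulate (f ∘ suc)))         ∎
  where open ≡-Reasoning

select-⇔ : ∀ {P Q : Set} (P? : Dec P) (Q? : Dec Q) → (P → Q) → (Q → P) → ∀ v → select P? v ≡ select Q? v
select-⇔ (yes _) (yes _) _ _ v = refl
select-⇔ (no _)  (no _)  _ _ v = refl
select-⇔ (yes P) (no ¬Q) f _ v = contradiction (f P) ¬Q
select-⇔ (no ¬P) (yes Q) _ g v = contradiction (g Q) ¬P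

≢𝟎⇒true : ∀ v → v ≢ 𝟎 → ∃[ c ] lookup v c ≡ true
≢𝟎⇒true v v≢𝟎 with any? (λ c → lookup v c ≟ᵇ true)
... | yes found = found
... | no  none  = contradiction (lookup-ext v 𝟎 λ c → trans (¬-not λ eq → none (c , eq)) (sym (lookup-replicate c false))) v≢𝟎

0<3 : 0 < 3
0<3 = s≤s z≤n

1<3 : 1 < 3
1<3 = s≤s (s≤s z≤n)

2<3 : 2 < 3
2<3 = n<1+n 2

-- Ranks in the construction order of a 3-tree

module ThreeTree {n} (G : Graph n) (σ : Fin n → Fin n) (σ-injective : Injective _≡_ _≡_ σ)
  (initial : ∀ i j → toℕ i < 4 → toℕ j < 4 → i ≢ j → Adj G (σ i) (σ j))
  (later : ∀ (i : Fin n) → 4 ≤ toℕ i →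
    ∃[ a ] ∃[ b ] ∃[ c ]
      (toℕ a < toℕ i × toℕ b < toℕ i × toℕ c < toℕ i) ×
      (a ≢ b × b ≢ c × a ≢ c) ×
      (Adj G (σ a) (σ b) × Adj G (σ b) (σ c) × Adj G (σ a) (σ c)) ×
      (∀ (j : Fin n) → toℕ j < toℕ i →
        (Adj G (σ i) (σ j) → (j ≡ a ⊎ j ≡ b ⊎ j ≡ c)) ×
        ((j ≡ a ⊎ j ≡ b ⊎ j ≡ c) → Adj G (σ i) (σ j)))) where

  -- Vertices are replaced by their ranks under `σ`, so the order of construction becomes `<` on the
  -- natural numbers.
  _~_ : ℕ → ℕ → Set
  u ~ v = ∃₂ λ i j → u ≡ toℕ i × v ≡ toℕ j × Adj G (σ i) (σ j)

  _~?_ : ∀ u v → Dec (u ~ v)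
  u ~? v = any? λ i → any? λ j → (u ≟ⁿ toℕ i) ×-dec (v ≟ⁿ toℕ j) ×-dec (adj G (σ i) (σ j) ≟ᵇ true)

  ~-sym : ∀ {u v} → u ~ v → v ~ u
  ~-sym (i , j , u≡i , v≡j , i~j) = j , i , v≡j , u≡i , trans (Graph.sym G (σ j) (σ i)) i~j

  ~⇒Adj : ∀ i j → toℕ i ~ toℕ j → Adj G (σ i) (σ j)
  ~⇒Adj i j (i′ , j′ , i≡ , j≡ , i~j) =
    subst₂ (λ i j → Adj G (σ i) (σ j)) (sym (toℕ-injective i≡)) (sym (toℕ-injective j≡)) i~j

  Adj⇒~ : ∀ {i j} → Adj G (σ i) (σ j) → toℕ i ~ toℕ j
  Adj⇒~ i~j = _ , _ , refl , refl , i~j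

  ~-irrefl : ∀ {u} → ¬ u ~ u
  ~-irrefl (i , j , refl , i≡j , i~j) = contradiction
    (trans (sym (Graph.irrefl G (σ i))) (subst (λ j → Adj G (σ i) (σ j)) (sym (toℕ-injective i≡j)) i~j)) λ ()

  open Colour _~_ _~?_ ~-sym ~-irrefl

  Unsorted : ℕ → ℕ → ℕ → ℕ → Set
  Unsorted m x y z =
    (x < m × y < m × z < m) × (x ≢ y × y ≢ z × x ≢ z) × (x ~ y × y ~ z × x ~ z) × (m ~ x × m ~ y × m ~ z) ×
    (∀ {j} → j < m → m ~ j → j ≡ x ⊎ j ≡ y ⊎ j ≡ z)

  swap₁₂ : ∀ {m x y z} → Unsorted m x y z → Unsorted m y x z
  swap₁₂ ((x<m , y<m , z<m) , (x≢y , y≢z , x≢z) , (x~y , y~z , x~z) , (m~x , m~y , m~z) , only) =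
    (y<m , x<m , z<m) , (x≢y ∘ sym , x≢z , y≢z) , (~-sym x~y , x~z , y~z) , (m~y , m~x , m~z) ,
    λ j<m m~j → [ inj₂ ∘ inj₁ , [ inj₁ , inj₂ ∘ inj₂ ]′ ]′ (only j<m m~j)

  swap₂₃ : ∀ {m x y z} → Unsorted m x y z → Unsorted m x z y
  swap₂₃ ((x<m , y<m , z<m) , (x≢y , y≢z , x≢z) , (x~y , y~z , x~z) , (m~x , m~y , m~z) , only) =
    (x<m , z<m , y<m) , (x≢z , y≢z ∘ sym , x≢y) , (x~z , ~-sym y~z , x~y) , (m~x , m~z , m~y) ,
    λ j<m m~j → [ inj₁ , [ inj₂ ∘ inj₂ , inj₂ ∘ inj₁ ]′ ]′ (only j<m m~j)

  sorted : ∀ {m x y z} → x < y → y < z → Unsorted m x y z → ∃[ T ] Parents m T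
  sorted {m} {x} {y} {z} x<y y<z ((_ , _ , z<m) , _ , adjacent , (m~x , m~y , m~z) , only) =
    x ∷ y ∷ z ∷ [] , ((x<y , y<z , z<m) , adjacent) , (λ { 0F → m~x ; 1F → m~y ; 2F → m~z }) ,
    λ j<m m~j → [ 0F ,_ , [ 1F ,_ , 2F ,_ ]′ ]′ (only j<m m~j)

  sort₃ : ∀ {m x y z} → x < y → Unsorted m x y z → ∃[ T ] Parents m T
  sort₃ {x = x} {y} {z} x<y unsorted@(_ , (_ , y≢z , x≢z) , _) with <-cmp y z | <-cmp x z
  ... | tri< y<z _ _ | _            = sorted x<y y<z unsorted
  ... | tri≈ _ y≡z _ | _            = contradiction y≡z y≢z
  ... | tri> _ _ z<y | tri< x<z _ _ = sorted x<z z<y (swap₂₃ unsorted)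
  ... | tri> _ _ _   | tri≈ _ x≡z _ = contradiction x≡z x≢z
  ... | tri> _ _ _   | tri> _ _ z<x = sorted z<x x<y (swap₁₂ (swap₂₃ unsorted))

  sort : ∀ {m x y z} → Unsorted m x y z → ∃[ T ] Parents m T
  sort {x = x} {y} unsorted@(_ , (x≢y , _) , _) with <-cmp x y
  ... | tri< x<y _ _ = sort₃ x<y unsorted
  ... | tri≈ _ x≡y _ = contradiction x≡y x≢y
  ... | tri> _ _ y<x = sort₃ y<x (swap₁₂ unsorted)

  initial-~ : ∀ {u v} → u < n → v < n → u < 4 → v < 4 → u ≢ v → u ~ v
  initial-~ u<n v<n u<4 v<4 u≢v = subst₂ _~_ (toℕ-fromℕ< u<n) (toℕ-fromℕ< v<n) (Adj⇒~ (initial _ _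
    (subst (_< 4) (sym (toℕ-fromℕ< u<n)) u<4) (subst (_< 4) (sym (toℕ-fromℕ< v<n)) v<4)
    λ eq → u≢v (trans (sym (toℕ-fromℕ< u<n)) (trans (cong toℕ eq) (toℕ-fromℕ< v<n)))))

  later-parents : ∀ i → 4 ≤ toℕ i → ∃[ T ] Parents (toℕ i) T
  later-parents i 4≤i with later i 4≤i
  ... | a , b , c , (a<i , b<i , c<i) , (a≢b , b≢c , a≢c) , (a~b , b~c , a~c) , earlier = sort
    ((a<i , b<i , c<i) , (a≢b ∘ toℕ-injective , b≢c ∘ toℕ-injective , a≢c ∘ toℕ-injective) ,
     (Adj⇒~ a~b , Adj⇒~ b~c , Adj⇒~ a~c) ,
     (Adj⇒~ (proj₂ (earlier a a<i) (inj₁ refl)) , Adj⇒~ (proj₂ (earlier b b<i) (inj₂ (inj₁ refl))) ,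
      Adj⇒~ (proj₂ (earlier c c<i) (inj₂ (inj₂ refl)))) , only)
    where
    only : ∀ {j} → j < toℕ i → toℕ i ~ j → j ≡ toℕ a ⊎ j ≡ toℕ b ⊎ j ≡ toℕ c
    only j<i i~j@(_ , j , _ , refl , _) = Sum.map (cong toℕ) (Sum.map (cong toℕ) (cong toℕ)) (proj₁ (earlier j j<i) (~⇒Adj i j i~j))

  parents-of : ∀ {m} → 3 ≤ m → m < n → ∃[ T ] Parents m T
  parents-of {m} 3≤m m<n with m≤n⇒m<n∨m≡n 3≤m
  ... | inj₁ 4≤m  = subst (λ m → ∃[ T ] Parents m T) (toℕ-fromℕ< m<n)
    (later-parents (fromℕ< m<n) (subst (4 ≤_) (sym (toℕ-fromℕ< m<n)) 4≤m))
  -- The fourth vertex of the initial K₄ counts as added to a triangle, so the induction can end at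
  -- three vertices.
  ... | inj₂ refl = sorted (n<1+n 0) (n<1+n 1)
    ((0<3 , 1<3 , 2<3) , ((λ ()) , (λ ()) , (λ ())) , (K₄ 0<3 1<3 (λ ()) , K₄ 1<3 2<3 (λ ()) , K₄ 0<3 2<3 (λ ())) ,
     (last 0<3 , last 1<3 , last 2<3) , only)
    where
    K₄ : ∀ {u v} → u < 3 → v < 3 → u ≢ v → u ~ v
    K₄ u<3 v<3 = initial-~ (<-trans u<3 m<n) (<-trans v<3 m<n) (m<n⇒m<1+n u<3) (m<n⇒m<1+n v<3)
    last : ∀ {u} → u < 3 → 3 ~ u
    last u<3 = initial-~ m<n (<-trans u<3 m<n) (n<1+n 3) (m<n⇒m<1+n u<3) λ { refl → <-irrefl refl u<3 }
    only : ∀ {j} → j < 3 → 3 ~ j → j ≡ 0 ⊎ j ≡ 1 ⊎ j ≡ 2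
    only {0} _ _ = inj₁ refl
    only {1} _ _ = inj₂ (inj₁ refl)
    only {2} _ _ = inj₂ (inj₂ refl)
    only {suc (suc (suc _))} (s≤s (s≤s (s≤s ())))

  σₚ : Permutation′ n
  σₚ = fromInjective σ σ-injective

  oddColourable : Solution n [] → OddColorable 5 G
  oddColourable record { φ = φ ; proper = proper ; δ = δ ; realises = [] δ≡𝟎 ; satisfied = satisfied } =
    ψ , ψ-proper , λ v _ → oddColour v
    where
    index : Fin n → Fin n
    index = σₚ ⟨$⟩ˡ_
    ψ : Fin n → Fin 5
    ψ v = φ (toℕ (index v))
    ψ-proper : IsProperColoring G ψ
    ψ-proper u v u~v = proper (toℕ<n (index u)) (toℕ<n (index v))
      (Adj⇒~ (subst₂ (Adj G) (sym (inverseʳ σₚ)) (sym (inverseʳ σₚ)) u~v))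
    module _ (v : Fin n) where
      N : Parity
      N = neighbours φ n (toℕ (index v))
      indicator : Fin n → Parity
      indicator u = select (adj G v u ≟ᵇ true) (unit (ψ u))
      N≢𝟎 : N ≢ 𝟎
      -- Nothing hangs on the whole tree, so `satisfied` speaks of the true neighbourhood.
      N≢𝟎 eq = satisfied (toℕ<n (index v)) (cong₂ _⊕_ eq (δ≡𝟎 (toℕ (index v))))
      N≡⨁ : N ≡ ⨁ indicator
      N≡⨁ = trans (sumTo-⨁ n (λ j → select (toℕ (index v) ~? j) (unit (φ j))))
        (trans (sum-cong-≗ reindex) (sym (sum-permute indicator σₚ)))
        where
        reindex : ∀ j → select (toℕ (index v) ~? toℕ j) (unit (φ (toℕ j))) ≡ indicator (σ j)
        reindex j = trans
          (select-⇔ (toℕ (index v) ~? toℕ j) (adj G v (σ j) ≟ᵇ true)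
            (λ v~j → subst (λ v → Adj G v (σ j)) (inverseʳ σₚ) (~⇒Adj (index v) j v~j))
            (λ v~j → Adj⇒~ (subst (λ v → Adj G v (σ j)) (sym (inverseʳ σₚ)) v~j))
            (unit (φ (toℕ j))))
          (cong (λ i → select (adj G v (σ j) ≟ᵇ true) (unit (φ (toℕ i)))) (sym (inverseˡ σₚ)))
      count : ∀ c u → lookup (indicator u) c ≡ odd (if adj G v u ∧ ⌊ ψ u ≟ c ⌋ then 1 else 0)
      count c u with adj G v u
      ... | false = lookup-replicate c false
      ... | true  = trans (lookup∘tabulate (λ c → does (ψ u ≟ c)) c) (bit (ψ u ≟ c))
        where
        bit : ∀ {P : Set} (P? : Dec P) → does P? ≡ odd (if ⌊ P? ⌋ then 1 else 0)
        bit (yes _) = refl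
        bit (no _)  = refl
      oddColour : ∃[ c ] Odd (nbrColorCount G ψ v c)
      oddColour with ≢𝟎⇒true N N≢𝟎
      ... | c , eq = c , odd⇒Odd (nbrColorCount G ψ v c) (begin
        odd (sum (List.map f (List.allFin n)))   ≡⟨ cong (odd ∘ sum) (map-tabulate id f) ⟩
        odd (sum (List.tabulate f))              ≡⟨ lookup-⨁ c indicator f (count c) ⟨
        lookup (⨁ indicator) c                   ≡⟨ cong (λ N → lookup N c) N≡⨁ ⟨
        lookup N c                               ≡⟨ eq ⟩
        true                                     ∎)
        where
        open ≡-Reasoning
        f : Fin n → ℕ
        f u = if adj G v u ∧ ⌊ ψ u ≟ c ⌋ then 1 else 0

theorem1p5 : (n : ℕ) (G : Graph n) → IsThreeTree G → OddColorable 5 G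
theorem1p5 (suc (suc (suc k))) G (4≤n@(s≤s (s≤s (s≤s _))) , σ , σ-injective , initial , later) =
  oddColourable (colour (K₃ 0<3 1<3 λ ()) (K₃ 1<3 2<3 λ ()) (K₃ 0<3 2<3 λ ()) k parents-of [] [])
  where
  open ThreeTree G σ σ-injective initial later
  open Colour _~_ _~?_ ~-sym ~-irrefl
  K₃ : ∀ {u v} → u < 3 → v < 3 → u ≢ v → u ~ v
  K₃ u<3 v<3 = initial-~ (<-trans u<3 4≤n) (<-trans v<3 4≤n) (m<n⇒m<1+n u<3) (m<n⇒m<1+n v<3)
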